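{- Let $n\geq 1$. There exists a bijection between the following two sets: (S1) the set of pairs $(M,\prec)$, where $M$ is a non-oriented map with $n$ edges and exactly one face, and $\prec$ is a linear order on the set of edges of $M$ such that for each $1\le i<n$, the ribbon graph obtained from the ribbon graph of $M$ by removing the first $i$ edges (according to $\prec$) has the same number of connected components as the number of its faces; (S2) the set of pairs $(M,\prec)$, where $M$ is an oriented map with $n$ edges and an arbitrary number of faces, and $\prec$ is an arbitrary linear order on the set of edges of $M$.
   Context: A map is a graph drawn on a surface (so that the faces are discs). All maps considered are bicolored (bipartite with a specified partition of the vertices into white and black vertices), connected, rooted (one edge is distinguished) and unlabeled (counted up to isomorphism). A map is oriented if the surface is orientable and equipped with a chosen orientation; it is non-oriented if no assumption on orientability of the surface is made. The ribbon graph of a map is the thickening of the map inside its surface: each vertex becomes a disc and each edge a ribbon (band) attached to the discs of its endpoints; removing an edge means deleting its ribbon. The faces of a ribbon graph correspond to its boundary components.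
   Formalization: A non-oriented map is rooted by distinguishing an edge together with one of its two sides, instead of only an edge; with only an edge distinguished the two sets have different sizes already for n = 3. -}

module Defs where

open import Data.Nat using (ℕ; zero; suc; _+_; _∸_; _≤_; _<_; _≤ᵇ_)
open import Data.Fin using (Fin; toℕ)
import Data.Fin as Fin
open import Data.Fin.Permutation using (Permutation′; _⟨$⟩ʳ_; _⟨$⟩ˡ_)
open import Data.Bool using (Bool; true; false; not; _∨_; _xor_; if_then_else_)
import Data.Bool as Bool
open import Data.Bool.Properties using (xor-identityʳ; xor-assoc; xor-same)
open import Data.List using (List; []; _∷_; length; allFin; concatMap; filterᵇ)
open import Data.Bool.ListAction using (any)
open import Data.Product using (Σ; _×_; _,_; proj₁; proj₂)
open import Data.Product.Properties using (≡-dec)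
open import Relation.Nullary using (¬_; does)
open import Relation.Binary.Definitions using (DecidableEquality)
open import Relation.Binary.Bundles using (Setoid)
open import Relation.Binary.Structures using (IsEquivalence)
open import Relation.Binary.PropositionalEquality
  using (_≡_; refl; sym; trans; cong; cong₂)

-- Generic: connected components of a graph on a finite carrier.
-- The graph has node list 'nodes' (a sub-list of the universe 'univ'),
-- and its edges are x — f x for f in the list 'fs'.  Reachability is a
-- path of length ≤ |univ| (which suffices on a graph with |univ| nodes),
-- so it is decidable and we can count classes.

module _ {A : Set} (_≟_ : DecidableEquality A) where

  reachIn : List (A → A) → ℕ → A → A → Bool
  reachIn fs zero    x y = does (x ≟ y)
  reachIn fs (suc k) x y = does (x ≟ y) ∨ any (λ f → reachIn fs k (f x) y) fs

  countClasses : (A → A → Bool) → List A → List A → ℕ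
  countClasses R seen []       = 0
  countClasses R seen (x ∷ xs) =
    if any (λ y → R y x) seen
    then countClasses R seen xs
    else suc (countClasses R (x ∷ seen) xs)

  numComponents : List (A → A) → (univ nodes : List A) → ℕ
  numComponents fs univ nodes = countClasses (reachIn fs (length univ)) [] nodes

-- Oriented bicoloured maps with n edges (edges labelled by Fin n):
-- σ = rotation of edges around white vertices, α = around black vertices.

orientedConnected : ∀ {n} → Permutation′ n → Permutation′ n → Set
orientedConnected {n} σ α =
  numComponents Fin._≟_
    ((σ ⟨$⟩ʳ_) ∷ (σ ⟨$⟩ˡ_) ∷ (α ⟨$⟩ʳ_) ∷ (α ⟨$⟩ˡ_) ∷ [])
    (allFin n) (allFin n) ≡ 1

-- An element of (S2): an oriented rooted map whose edges are labelled
-- 0,…,n-1 according to the linear order ≺ (so isomorphisms preserving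
-- the order are the identity), together with its root edge.
record OrientedOrdered (n : ℕ) : Set where
  field
    σ     : Permutation′ n
    α     : Permutation′ n
    root  : Fin n
    conn  : orientedConnected σ α

_≈O_ : ∀ {n} → OrientedOrdered n → OrientedOrdered n → Set
M ≈O M' =
  (∀ i → OrientedOrdered.σ M ⟨$⟩ʳ i ≡ OrientedOrdered.σ M' ⟨$⟩ʳ i) ×
  (∀ i → OrientedOrdered.α M ⟨$⟩ʳ i ≡ OrientedOrdered.α M' ⟨$⟩ʳ i) ×
  (OrientedOrdered.root M ≡ OrientedOrdered.root M')

S2 : ℕ → Setoid _ _
S2 n = record
  { Carrier = OrientedOrdered n
  ; _≈_ = _≈O_
  ; isEquivalence = record
    { refl  = (λ _ → refl) , (λ _ → refl) , refl
    ; sym   = λ (a , b , c) → (λ i → sym (a i)) , (λ i → sym (b i)) , sym c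
    ; trans = λ (a , b , c) (a' , b' , c') →
        (λ i → trans (a i) (a' i)) , (λ i → trans (b i) (b' i)) , trans c c'
    }
  }

-- Non-oriented bicoloured maps with n edges (Goulden–Jackson encoding).
-- Each edge e ∈ Fin n has two sides (e , false), (e , true); the matching
-- g pairs the two sides of each edge; w (resp. b) is a perfect matching
-- on sides, pairing sides consecutive around white (resp. black) vertices.
-- White vertices = components of {g,w}; black = {g,b}; faces = {w,b};
-- connected components = {g,w,b}.

Side : ℕ → Set
Side n = Fin n × Bool

_≟S_ : ∀ {n} → DecidableEquality (Side n)
_≟S_ = ≡-dec Fin._≟_ Bool._≟_

allSides : ∀ n → List (Side n)
allSides n = concatMap (λ e → (e , false) ∷ (e , true) ∷ []) (allFin n)

gS : ∀ {n} → Side n → Side n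
gS (e , s) = (e , not s)

IsMatching : ∀ {n} → (Side n → Side n) → Set
IsMatching m = (∀ x → m (m x) ≡ x) × (∀ x → ¬ (m x ≡ x))

alive : ∀ {n} → ℕ → Side n → Bool
alive i (e , _) = i ≤ᵇ toℕ e

aliveSides : ∀ n → ℕ → List (Side n)
aliveSides n i = filterᵇ (alive i) (allSides n)

-- the vertex matching m of the ribbon graph after removing the first i
-- edges: go around the vertex (y ↦ m (g y)) until a surviving side is met
nextAlive : ∀ {n} → ℕ → ℕ → (Side n → Side n) → Side n → Side n
nextAlive zero    i m y = y
nextAlive (suc k) i m y = if alive i y then y else nextAlive k i m (m (gS y))

restrict : ∀ {n} → ℕ → (Side n → Side n) → Side n → Side n
restrict {n} i m x = nextAlive n i m (m x)

-- number of vertices (orbits of {g,m}) all of whose edges were removed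
isolated : ∀ {n} → ℕ → (Side n → Side n) → ℕ
isolated {n} i m =
  numComponents _≟S_ (gS ∷ m ∷ []) (allSides n) (allSides n)
  ∸ numComponents _≟S_ (gS ∷ m ∷ []) (allSides n) (aliveSides n i)

-- connected components / faces of the ribbon graph obtained by removing
-- the first i edges (isolated vertices count as components and faces)
componentsAfter : ∀ {n} → ℕ → (w b : Side n → Side n) → ℕ
componentsAfter {n} i w b =
  numComponents _≟S_ (gS ∷ restrict i w ∷ restrict i b ∷ [])
    (allSides n) (aliveSides n i)
  + isolated i w + isolated i b

facesAfter : ∀ {n} → ℕ → (w b : Side n → Side n) → ℕ
facesAfter {n} i w b =
  numComponents _≟S_ (restrict i w ∷ restrict i b ∷ [])
    (allSides n) (aliveSides n i)
  + isolated i w + isolated i b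

-- An element of (S1): a non-oriented map with edges labelled 0,…,n-1
-- according to ≺, rooted at a side of an edge.
record NonOrientedOrdered (n : ℕ) : Set where
  field
    w      : Side n → Side n
    b      : Side n → Side n
    w-match : IsMatching w
    b-match : IsMatching b
    root    : Side n
    conn    : numComponents _≟S_ (gS ∷ w ∷ b ∷ []) (allSides n) (allSides n) ≡ 1
    oneFace : numComponents _≟S_ (w ∷ b ∷ []) (allSides n) (allSides n) ≡ 1
    cond    : ∀ i → 1 ≤ i → i < n → componentsAfter i w b ≡ facesAfter i w b

-- isomorphisms preserving the edge labels (hence ≺): swap the two sides
-- of some edges
flipS : ∀ {n} → (Fin n → Bool) → Side n → Side n
flipS s (e , t) = (e , t xor s e)

_≈N_ : ∀ {n} → NonOrientedOrdered n → NonOrientedOrdered n → Set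
_≈N_ {n} M M' = Σ (Fin n → Bool) λ s →
  (∀ x → flipS s (N.w M x) ≡ N.w M' (flipS s x)) ×
  (∀ x → flipS s (N.b M x) ≡ N.b M' (flipS s x)) ×
  (flipS s (N.root M) ≡ N.root M')
  where module N = NonOrientedOrdered

private
  flip-id : ∀ {n} (x : Side n) → flipS (λ _ → false) x ≡ x
  flip-id (e , t) = cong (e ,_) (xor-identityʳ t)

  flip-inv : ∀ {n} s (x : Side n) → flipS s (flipS s x) ≡ x
  flip-inv s (e , t) =
    cong (e ,_) (trans (xor-assoc t (s e) (s e))
                  (trans (cong (t xor_) (xor-same (s e))) (xor-identityʳ t)))

  flip-comp : ∀ {n} s s' (x : Side n) →
              flipS (λ e → s e xor s' e) x ≡ flipS s' (flipS s x)
  flip-comp s s' (e , t) = cong (e ,_) (sym (xor-assoc t (s e) (s' e)))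

  symℓ : ∀ {n} s (m m' : Side n → Side n) →
         (∀ x → flipS s (m x) ≡ m' (flipS s x)) →
         (∀ x → flipS s (m' x) ≡ m (flipS s x))
  symℓ s m m' h x =
    trans (cong (λ y → flipS s (m' y)) (sym (flip-inv s x)))
   (trans (cong (flipS s) (sym (h (flipS s x))))
          (flip-inv s (m (flipS s x))))

  transℓ : ∀ {n} s s' (m m' m'' : Side n → Side n) →
           (∀ x → flipS s (m x) ≡ m' (flipS s x)) →
           (∀ x → flipS s' (m' x) ≡ m'' (flipS s' x)) →
           (∀ x → flipS (λ e → s e xor s' e) (m x) ≡ m'' (flipS (λ e → s e xor s' e) x))
  transℓ s s' m m' m'' h h' x =
    trans (flip-comp s s' (m x))
   (trans (cong (flipS s') (h x))
   (trans (h' (flipS s x))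
          (cong m'' (sym (flip-comp s s' x)))))

S1 : ℕ → Setoid _ _
S1 n = record
  { Carrier = NonOrientedOrdered n
  ; _≈_ = _≈N_
  ; isEquivalence = record
    { refl  = λ {M} → (λ _ → false)
            , (λ x → trans (flip-id _) (cong (N.w M) (sym (flip-id x))))
            , (λ x → trans (flip-id _) (cong (N.b M) (sym (flip-id x))))
            , flip-id _
    ; sym   = λ {M} {M'} (s , hw , hb , hr) →
              s , symℓ s (N.w M) (N.w M') hw , symℓ s (N.b M) (N.b M') hb
                , trans (cong (flipS s) (sym hr)) (flip-inv s (N.root M))
    ; trans = λ {M} {M'} {M''} (s , hw , hb , hr) (s' , hw' , hb' , hr') →
              (λ e → s e xor s' e)
              , transℓ s s' (N.w M) (N.w M') (N.w M'') hw hw'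
              , transℓ s s' (N.b M) (N.b M') (N.b M'') hb hb'
              , trans (flip-comp s s' (N.root M)) (trans (cong (flipS s') hr) hr')
    }
  }
  where module N = NonOrientedOrdered

{-# OPTIONS --safe #-}

-- Remove the edges one at a time.  In a map satisfying the condition of (S1) every component
-- of each intermediate ribbon graph has a single face.  Put an edge back: if it connects two
-- components, or brings a new vertex, the faces merge whether or not it is twisted; if both
-- its ends lie on the same face, exactly one of its two twists keeps that face in one piece.
-- The edges of the first kind form a spanning tree of the map, so local orientations of the
-- vertices can be chosen, uniquely once the root is oriented, such that all tree edges are
-- untwisted.  These orientations turn the vertex rotations into permutations, that is, into
-- an oriented map; conversely the twists of the remaining edges are forced by the condition.
module Submission where

open import Defs
open import Data.Bool using (Bool; true; false; not; T; _∨_; _xor_)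
import Data.Bool as Bool
open import Data.Bool.ListAction using (any)
open import Data.Bool.Properties
  using (T-∨; T?; not-involutive; xor-identityʳ; xor-assoc; xor-same; not-¬; ¬-not)
open import Data.Empty using (⊥; ⊥-elim)
open import Data.Fin using (Fin; zero; suc; toℕ)
import Data.Fin as Fin
open import Data.Fin.Permutation
  using (Permutation′; permutation; _⟨$⟩ʳ_; _⟨$⟩ˡ_; inverseˡ; inverseʳ)
open import Data.Fin.Properties using (pigeonhole; toℕ≤pred[n])
open import Data.List using (List; []; _∷_; length; lookup)
open import Data.List.Membership.Propositional using (_∈_; find; lose)
open import Data.List.Membership.Propositional.Properties
  using (∈-allFin; ∈-concatMap⁺; ∈-filter⁺; ∈-filter⁻)
open import Data.List.Relation.Unary.All as All using (All; []; _∷_)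
open import Data.List.Relation.Unary.Any as Any using (Any; here; there)
open import Data.List.Relation.Unary.Any.Properties using (any⁺; any⁻; lookup-index)
open import Data.Nat using (ℕ; zero; suc; _+_; _≤_; _<_; z≤n; s≤s; z<s; s<s; _≤?_)
open import Data.Nat.Induction using (<-rec)
open import Data.Nat.Properties
  using (≤-refl; ≤-trans; ≰⇒>; 1+n≰n; m≤n⇒m≤1+n; m≤n+m; m≤n⇒∃[o]m+o≡n; suc-injective;
         +-comm; +-cancelʳ-≡)
open import Data.Product using (Σ; ∃; _×_; _,_; proj₁; proj₂)
open import Data.Sum using (_⊎_; inj₁; inj₂; [_,_]′)
open import Data.Unit using (⊤; tt)
open import Function.Base using (_∘_; id)
open import Function.Bundles using (Bijection; Equivalence; mk⇔)
open import Relation.Binary.Construct.Closure.ReflexiveTransitive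
  using (Star; ε; _◅_; _◅◅_; gmap; kleisliStar; reverse)
open import Relation.Binary.Definitions using (DecidableEquality)
open import Relation.Binary.PropositionalEquality
  using (_≡_; refl; sym; trans; cong; cong₂; subst; subst₂)
open import Relation.Nullary using (¬_; Dec; does; yes; no; contradiction)
open import Relation.Nullary.Decidable
  using (_⊎-dec_; dec-false; dec-true; decidable-stable; does-⇔; map′)

-- Every face lies in one component, so equal numbers of faces and components mean equal partitions.
-- The numerical condition thus becomes the local statement `Glued`: the two sides of each edge lie
-- on one face. The recursion deletes edge zero, the first in the order, and renumbers the others;
-- this gives `Good`. An orientation of the vertices is a pair of Boolean functions on edges, `f`
-- for white ends and `h` for black ends. An edge is twisted when they differ, and a twist relabels
-- the sides of an edge at its black end only. Neither construction is shown to invert the other.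
-- Both produce pairs in the relation `Corresponds`, which respects equality of maps in both
-- directions; well-definedness, injectivity and surjectivity all follow from this.

-- Reachability and shortening of paths

Step : {A : Set} → List (A → A) → A → A → Set
Step fs x y = Any (λ f → f x ≡ y) fs

Reach : {A : Set} → List (A → A) → A → A → Set
Reach fs = Star (Step fs)

step-∈ : {A : Set} {f : A → A} {fs : List (A → A)} → f ∈ fs → ∀ x → Step fs x (f x)
step-∈ f∈ x = Any.map (λ { refl → refl }) f∈

reach-closed : {A : Set} {fs : List (A → A)} (K : A → Set) →
               (∀ {x y} → Step fs x y → K x → K y) → ∀ {x y} → Reach fs x y → K x → K y
reach-closed K c ε       k = k
reach-closed K c (s ◅ r) k = reach-closed K c r (c s k)

data Path {A : Set} (fs : List (A → A)) : ℕ → A → A → Set where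
  []  : ∀ {x} → Path fs zero x x
  _∷_ : ∀ {x y z k} → Step fs x y → Path fs k y z → Path fs (suc k) x z

module _ {A : Set} {fs : List (A → A)} where

  vertex : ∀ {k x y} → Path fs k x y → Fin (suc k) → A
  vertex {x = x} p       zero    = x
  vertex         (_ ∷ p) (suc i) = vertex p i

  suffix : ∀ {k x y} (p : Path fs k x y) j → ∃ λ k′ → k′ ≤ k × Path fs k′ (vertex p j) y
  suffix p       zero    = _ , ≤-refl , p
  suffix (_ ∷ p) (suc j) = let k′ , k′≤k , q = suffix p j in k′ , m≤n⇒m≤1+n k′≤k , q

  cutLoop : ∀ {k x y} (p : Path fs k x y) i j → i Fin.< j → vertex p i ≡ vertex p j →
            ∃ λ k′ → k′ < k × Path fs k′ x y
  cutLoop (_ ∷ p) zero    (suc j) _         eq =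
    let k′ , k′≤k , q = suffix p j in
    k′ , s≤s k′≤k , subst (λ v → Path fs k′ v _) (sym eq) q
  cutLoop (s ∷ p) (suc i) (suc j) (s≤s i<j) eq =
    let k′ , k′<k , q = cutLoop p i j i<j eq in suc k′ , s≤s k′<k , s ∷ q

  -- `reachIn` explores paths of bounded length only. A longer path repeats a vertex, and the loop
  -- between the repetitions is cut out.
  shorten : ∀ {N} (c : A → Fin N) → (∀ {x y} → c x ≡ c y → x ≡ y) →
            ∀ k {x y} → Path fs k x y → ∃ λ k′ → k′ ≤ N × Path fs k′ x y
  shorten {N} c inj = <-rec _ go
    where
    go : ∀ k → (∀ {j} → j < k → ∀ {x y} → Path fs j x y → ∃ λ k′ → k′ ≤ N × Path fs k′ x y) →
         ∀ {x y} → Path fs k x y → ∃ λ k′ → k′ ≤ N × Path fs k′ x y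
    go k rec p with k ≤? N
    ... | yes k≤N = k , k≤N , p
    ... | no  k≰N =
      let i , j , i<j , eq = pigeonhole (m≤n⇒m≤1+n (≰⇒> k≰N)) (c ∘ vertex p)
          k′ , k′<k , q = cutLoop p i j i<j (inj eq)
      in rec k′<k q

  reach⇒path : ∀ {x y} → Reach fs x y → ∃ λ k → Path fs k x y
  reach⇒path ε       = _ , []
  reach⇒path (s ◅ r) = let _ , p = reach⇒path r in _ , s ∷ p

-- Counting classes and comparing partitions

T⇔⇒≡ : ∀ {a b} → (T a → T b) → (T b → T a) → a ≡ b
T⇔⇒≡ {false} {false} f g = refl
T⇔⇒≡ {false} {true}  f g = ⊥-elim (g tt)
T⇔⇒≡ {true}  {false} f g = ⊥-elim (f tt)
T⇔⇒≡ {true}  {true}  f g = refl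

does⁺ : {P : Set} (P? : Dec P) → P → T (does P?)
does⁺ (yes _) _ = tt
does⁺ (no ¬p) p = ¬p p

does⁻ : {P : Set} (P? : Dec P) → T (does P?) → P
does⁻ (yes p) _ = p

module Counting {A : Set} (_≟_ : DecidableEquality A) where

  path⇒reachIn : ∀ fs {m k x y} → Path fs m x y → m ≤ k → T (reachIn _≟_ fs k x y)
  path⇒reachIn fs {k = zero}  {x} []      _         = does⁺ (x ≟ x) refl
  path⇒reachIn fs {k = suc k} {x} []      _         =
    Equivalence.from T-∨ (inj₁ (does⁺ (x ≟ x) refl))
  path⇒reachIn fs {k = suc k} {x} (s ∷ p) (s≤s m≤k) =
    Equivalence.from T-∨ (inj₂ (any⁺ _ (Any.map (λ { refl → path⇒reachIn fs p m≤k }) s)))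

  reachIn⇒reach : ∀ fs k {x y} → T (reachIn _≟_ fs k x y) → Reach fs x y
  reachIn⇒reach fs zero {x} {y} t with refl ← does⁻ (x ≟ y) t = ε
  reachIn⇒reach fs (suc k) {x} {y} t with Equivalence.to T-∨ t
  ... | inj₁ t′ with refl ← does⁻ (x ≟ y) t′ = ε
  ... | inj₂ t′ with f , f∈ , t″ ← find (any⁻ _ fs t′) = step-∈ f∈ x ◅ reachIn⇒reach fs k t″

  Represented : (A → A → Bool) → List A → A → Set
  Represented R seen x = Any (λ y → T (R y x)) seen

  module _ {P : A → Set} {R R′ : A → A → Bool}
           (R≗R′ : ∀ {x y} → P x → P y → R x y ≡ R′ x y) where

    any-cong : ∀ {ys x} → All P ys → P x → any (λ y → R y x) ys ≡ any (λ y → R′ y x) ys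
    any-cong []       q = refl
    any-cong (p ∷ ps) q = cong₂ _∨_ (R≗R′ p q) (any-cong ps q)

    countClasses-cong : ∀ {seen} xs → All P seen → All P xs →
                        countClasses _≟_ R seen xs ≡ countClasses _≟_ R′ seen xs
    countClasses-cong []       ps []       = refl
    countClasses-cong {seen} (x ∷ xs) ps (q ∷ qs)
      rewrite any-cong ps q with any (λ y → R′ y x) seen
    ... | true  = countClasses-cong xs ps qs
    ... | false = cong suc (countClasses-cong xs (q ∷ ps) qs)

  module _ {R R′ : A → A → Bool}
           (R⊆R′ : ∀ {x y} → T (R x y) → T (R′ x y))
           (reflR : ∀ {x} → T (R x x))
           (refl′ : ∀ {x} → T (R′ x x))
           (trans′ : ∀ {x y z} → T (R′ x y) → T (R′ y z) → T (R′ x z)) where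

    coarsen : ∀ {seen seen′ x} → All (Represented R′ seen′) seen →
              Represented R seen x → Represented R′ seen′ x
    coarsen a i with y , y∈ , r ← find i = Any.map (λ r′ → trans′ r′ (R⊆R′ r)) (All.lookup a y∈)

    -- The invariant: whatever the finer run has chosen is represented in the coarser run. Hence the
    -- coarser run skips every node that the finer run skips.
    countClasses-mono : ∀ {seen seen′} xs → All (Represented R′ seen′) seen →
                        countClasses _≟_ R′ seen′ xs ≤ countClasses _≟_ R seen xs
    countClasses-mono [] a = z≤n
    countClasses-mono {seen} {seen′} (x ∷ xs) a
      with any (λ y → R y x) seen in eq | any (λ y → R′ y x) seen′ in eq′
    ... | true  | true  = countClasses-mono xs a
    ... | true  | false =
      ⊥-elim (subst T eq′ (any⁺ _ (coarsen a (any⁻ _ seen (subst T (sym eq) tt)))))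
    ... | false | true  =
      m≤n⇒m≤1+n (countClasses-mono xs (any⁻ _ seen′ (subst T (sym eq′) tt) ∷ a))
    ... | false | false = s≤s (countClasses-mono xs (here refl′ ∷ All.map there a))

    module _ {P : A → Set} (sym′ : ∀ {x y} → P x → P y → T (R′ x y) → T (R′ y x)) where

      Separated : List A → Set
      Separated S = ∀ {s t} → s ∈ S → t ∈ S → T (R′ s t) → s ≡ t

      -- If the totals agree, the two greedy runs take the same decision at every node, so one list
      -- serves both: complete for the finer relation, separated for the coarser one. Symmetry is
      -- asked on the nodes only, because restricted matchings are involutive only on surviving
      -- sides.
      representatives : ∀ {seen} xs → All P seen → All P xs → Separated seen →
        countClasses _≟_ R seen xs ≡ countClasses _≟_ R′ seen xs →
        ∃ λ S → All P S × (∀ {s} → s ∈ seen → s ∈ S) × Separated S × All (Represented R S) xs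
      representatives {seen} [] ps [] sep _ = seen , ps , id , sep , []
      representatives {seen} (x ∷ xs) ps (p ∷ qs) sep eq
        with any (λ y → R y x) seen in e | any (λ y → R′ y x) seen in e′
      ... | true  | true  =
        let S , pS , ⊆S , sepS , rep = representatives xs ps qs sep eq
            _ , y∈ , r = find (any⁻ _ seen (subst T (sym e) tt))
        in S , pS , ⊆S , sepS , lose (⊆S y∈) r ∷ rep
      ... | true  | false =
        ⊥-elim (subst T e′ (any⁺ _ (Any.map R⊆R′ (any⁻ _ seen (subst T (sym e) tt)))))
      -- The coarser run falls behind by one here and, by monotonicity, cannot catch up.
      ... | false | true  =
        ⊥-elim (1+n≰n (subst (_≤ _) (sym eq)
          (countClasses-mono xs (any⁻ _ seen (subst T (sym e′) tt)
                                 ∷ All.tabulate (λ y∈ → lose y∈ refl′)))))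
      ... | false | false =
        let S , pS , ⊆S , sepS , rep = representatives xs (p ∷ ps) qs sep₁ (suc-injective eq)
        in S , pS , ⊆S ∘ there , sepS , lose (⊆S (here refl)) reflR ∷ rep
        where
        new : ∀ {s} → s ∈ seen → ¬ T (R′ s x)
        new s∈ r = subst T e′ (any⁺ _ (lose s∈ r))
        sep₁ : Separated (x ∷ seen)
        sep₁ (here refl) (here refl) r = refl
        sep₁ (here refl) (there t∈)  r = ⊥-elim (new t∈ (sym′ p (All.lookup ps t∈) r))
        sep₁ (there s∈)  (here refl) r = ⊥-elim (new s∈ r)
        sep₁ (there s∈)  (there t∈)  r = sep s∈ t∈ r

      countClasses-≡⇒⊇ : ∀ {xs} → (∀ {x y} → P x → P y → T (R x y) → T (R y x)) →
        (∀ {x y z} → T (R x y) → T (R y z) → T (R x z)) → All P xs →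
        countClasses _≟_ R [] xs ≡ countClasses _≟_ R′ [] xs →
        ∀ {x y} → x ∈ xs → y ∈ xs → T (R′ x y) → T (R x y)
      countClasses-≡⇒⊇ {xs} symR transR ps eq x∈ y∈ r
        with S , pS , _ , sep , rep ← representatives xs [] ps (λ ()) eq
        with s , s∈ , sx ← find (All.lookup rep x∈)
        with t , t∈ , ty ← find (All.lookup rep y∈)
        with refl ← sep s∈ t∈ (trans′ (trans′ (R⊆R′ sx) r)
                                      (sym′ (All.lookup pS t∈) (All.lookup ps y∈) (R⊆R′ ty)))
        = transR (symR (All.lookup pS s∈) (All.lookup ps x∈) sx) ty

  countClasses-total : ∀ {z xs} → z ∈ xs → countClasses _≟_ (λ _ _ → true) [] xs ≡ 1
  countClasses-total {xs = x ∷ xs} _ = cong suc (go xs)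
    where
    go : ∀ xs → countClasses _≟_ (λ _ _ → true) (x ∷ []) xs ≡ 0
    go []       = refl
    go (_ ∷ xs) = go xs

  module _ {univ : List A} (complete : ∀ x → x ∈ univ) where

    index-injective : ∀ {x y} → Any.index (complete x) ≡ Any.index (complete y) → x ≡ y
    index-injective {x} {y} eq =
      trans (lookup-index (complete x))
            (trans (cong (lookup univ) eq) (sym (lookup-index (complete y))))

    reach⇒reachIn : ∀ fs {x y} → Reach fs x y → T (reachIn _≟_ fs (length univ) x y)
    reach⇒reachIn fs r =
      let k , p        = reach⇒path r
          _ , k′≤ , p′ = shorten (Any.index ∘ complete) index-injective k p
      in path⇒reachIn fs p′ k′≤

    sound : ∀ fs {x y} → T (reachIn _≟_ fs (length univ) x y) → Reach fs x y
    sound fs = reachIn⇒reach fs (length univ)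

    transitive : ∀ fs {x y z} → T (reachIn _≟_ fs (length univ) x y) →
                 T (reachIn _≟_ fs (length univ) y z) → T (reachIn _≟_ fs (length univ) x z)
    transitive fs {y = y} a b = reach⇒reachIn fs (sound fs {y = y} a ◅◅ sound fs b)

    reach? : ∀ fs x y → Dec (Reach fs x y)
    reach? fs x y = map′ (sound fs) (reach⇒reachIn fs) (T? _)

    module _ {nodes : List A} where

      Symmetric-on : List (A → A) → Set
      Symmetric-on fs = ∀ {x y} → x ∈ nodes → y ∈ nodes → Reach fs x y → Reach fs y x

      numComponents-cong : ∀ {fs gs} →
        (∀ {x y} → x ∈ nodes → y ∈ nodes → Reach fs x y → Reach gs x y) →
        (∀ {x y} → x ∈ nodes → y ∈ nodes → Reach gs x y → Reach fs x y) →
        numComponents _≟_ fs univ nodes ≡ numComponents _≟_ gs univ nodes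
      numComponents-cong {fs} {gs} to from =
        countClasses-cong
          (λ p q → T⇔⇒≡ (reach⇒reachIn gs ∘ to p q ∘ sound fs)
                        (reach⇒reachIn fs ∘ from p q ∘ sound gs))
          nodes [] (All.tabulate id)

      numComponents-≡⇒⊇ : ∀ {fs gs} → (∀ {x y} → Reach fs x y → Reach gs x y) →
        Symmetric-on fs → Symmetric-on gs →
        numComponents _≟_ fs univ nodes ≡ numComponents _≟_ gs univ nodes →
        ∀ {x y} → x ∈ nodes → y ∈ nodes → Reach gs x y → Reach fs x y
      numComponents-≡⇒⊇ {fs} {gs} sub symF symG eq p q =
        sound fs ∘
        countClasses-≡⇒⊇
          (reach⇒reachIn gs ∘ sub ∘ sound fs)
          (reach⇒reachIn fs ε)
          (reach⇒reachIn gs ε)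
          (transitive gs)
          (λ p q → reach⇒reachIn gs ∘ symG p q ∘ sound gs)
          (λ p q → reach⇒reachIn fs ∘ symF p q ∘ sound fs)
          (transitive fs)
          (All.tabulate id) eq p q ∘
        reach⇒reachIn gs

      connected⇒numComponents≡1 : ∀ {fs z} → z ∈ nodes →
        (∀ {x y} → x ∈ nodes → y ∈ nodes → Reach fs x y) →
        numComponents _≟_ fs univ nodes ≡ 1
      connected⇒numComponents≡1 {fs} z∈ con =
        trans (countClasses-cong (λ p q → T⇔⇒≡ _ (λ _ → reach⇒reachIn fs (con p q)))
                                 nodes [] (All.tabulate id))
              (countClasses-total z∈)

      -- The comparison is with the total relation, whose count is one.
      numComponents≡1⇒connected : ∀ {fs} → Symmetric-on fs →
        numComponents _≟_ fs univ nodes ≡ 1 →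
        ∀ {x y} → x ∈ nodes → y ∈ nodes → Reach fs x y
      numComponents≡1⇒connected {fs} symF eq p q =
        sound fs
          (countClasses-≡⇒⊇ {R′ = λ _ _ → true} _ (reach⇒reachIn fs ε) _ _ _
            (λ p q → reach⇒reachIn fs ∘ symF p q ∘ sound fs)
            (transitive fs)
            (All.tabulate id) (trans eq (sym (countClasses-total p))) p q _)

-- Alternating walks of two involutions

involution-injective : {A : Set} (f : A → A) → (∀ x → f (f x) ≡ x) → ∀ {x y} → f x ≡ f y → x ≡ y
involution-injective f inv {x} {y} eq = trans (sym (inv x)) (trans (cong f eq) (inv y))

module AlternatingWalk {A : Set} {p q : A → A}
  (p-inv : ∀ x → p (p x) ≡ x) (p-fpf : ∀ x → ¬ (p x ≡ x))
  (q-inv : ∀ x → q (q x) ≡ x) (q-fpf : ∀ x → ¬ (q x ≡ x))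
  {S : A → Set} (S? : ∀ x → Dec (S x)) (S-q : ∀ {x} → S x → S (q x)) where

  p-injective : ∀ {x y} → p x ≡ p y → x ≡ y
  p-injective = involution-injective p p-inv

  q-injective : ∀ {x y} → q x ≡ q y → x ≡ y
  q-injective = involution-injective q q-inv

  -- The walk stops when `p` first enters `S`. With `p` a corner matching, it serves both to travel
  -- along a face (`q` the other matching) and to go around a vertex past removed edges (`q` is
  -- `gS`).
  data Walk : ℕ → A → A → Set where
    done : ∀ {x}     → S (p x) → Walk zero x (p x)
    step : ∀ {x z k} → ¬ S (p x) → Walk k (q (p x)) z → Walk (suc k) x z

  walk-end : ∀ {k x z} → Walk k x z → S z
  walk-end (done s)   = s
  walk-end (step _ w) = walk-end w

  walk-functional : ∀ {k l x y z} → Walk k x y → Walk l x z → y ≡ z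
  walk-functional (done _)   (done _)    = refl
  walk-functional (done s)   (step ¬s _) = contradiction s ¬s
  walk-functional (step ¬s _) (done s)   = contradiction s ¬s
  walk-functional (step _ v) (step _ w)  = walk-functional v w

  iter : ℕ → A → A
  iter zero    x = x
  iter (suc k) x = iter k (q (p x))

  iter-suc : ∀ k x → iter (suc k) x ≡ q (p (iter k x))
  iter-suc zero    x = refl
  iter-suc (suc k) x = iter-suc k (q (p x))

  iter-+ : ∀ i k x → iter (i + k) x ≡ iter k (iter i x)
  iter-+ zero    k x = refl
  iter-+ (suc i) k x = iter-+ i k (q (p x))

  iter-injective : ∀ k {x y} → iter k x ≡ iter k y → x ≡ y
  iter-injective zero    eq = eq
  iter-injective (suc k) eq =
    p-injective (q-injective (iter-injective k eq))

  -- A walk that closed up this way would be a palindrome, and its middle would be a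
  -- fixed point of p or q.
  no-palindrome : ∀ k x → ¬ (p (iter k x) ≡ x)
  no-palindrome zero          x eq = p-fpf x eq
  no-palindrome (suc zero)    x eq =
    q-fpf (p x) (p-injective (trans eq (sym (p-inv x))))
  no-palindrome (suc (suc k)) x eq = no-palindrome k (q (p x))
    (q-injective
      (trans (sym (iter-suc k (q (p x))))
      (trans (p-injective (trans eq (sym (p-inv x)))) (sym (q-inv (p x))))))

  walk-≢ : ∀ {k x z} → Walk k x z → ¬ (z ≡ x)
  walk-≢ {k} {x} w eq = no-palindrome k x (trans (sym (endpoint w)) eq)
    where
    endpoint : ∀ {k x z} → Walk k x z → z ≡ p (iter k x)
    endpoint (done _)   = refl
    endpoint (step _ w) = endpoint w

  walk-within : ∀ k x → (∃ λ j → j ≤ k × ∃ (Walk j x)) ⊎ (∀ {i} → i ≤ k → ¬ S (p (iter i x)))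
  walk-within k x with S? (p x)
  walk-within k       x | yes s = inj₁ (zero , z≤n , _ , done s)
  walk-within zero    x | no ¬s = inj₂ λ { z≤n → ¬s }
  walk-within (suc k) x | no ¬s with walk-within k (q (p x))
  ... | inj₁ (j , j≤k , z , w) = inj₁ (suc j , s≤s j≤k , z , step ¬s w)
  ... | inj₂ never = inj₂ λ { z≤n → ¬s ; (s≤s i≤k) → never i≤k }

  -- Without an exit, a value of `c` repeats. If a point recurs, running both occurrences back to
  -- the start shows that the walk had already come to `q x`, which lies in `S`. If `u` and `q u`
  -- both occur, the walk has turned back on itself, against `no-palindrome`. Fibres of size two are
  -- allowed so that edges can be counted instead of sides.
  walk-exists : ∀ {N} (c : A → Fin N) → (∀ {u v} → c u ≡ c v → u ≡ v ⊎ u ≡ q v) →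
                ∀ {x} → S x → ∃ λ k → k ≤ N × ∃ (Walk k x)
  walk-exists {N} c c-fibre {x} Sx with walk-within N x
  ... | inj₁ found = found
  ... | inj₂ never
    with i , j , i<j , same ← pigeonhole {N} {suc N} ≤-refl (λ i → c (p (iter (toℕ i) x)))
    with k , eq ← m≤n⇒∃[o]m+o≡n i<j
    = ⊥-elim ([ returns , palindrome ]′ (c-fibre same))
    where
    j≡ : toℕ j ≡ suc k + toℕ i
    j≡ = trans (sym eq) (cong suc (+-comm (toℕ i) k))
    returns : ¬ (p (iter (toℕ i) x) ≡ p (iter (toℕ j) x))
    returns e = never k≤N (subst S (trans (cong q back) (q-inv _)) (S-q Sx))
      where
      back : x ≡ q (p (iter k x))
      back = trans (iter-injective (toℕ i)
                     (trans (p-injective e)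
                            (trans (cong (λ m → iter m x) j≡) (iter-+ (suc k) (toℕ i) x))))
                   (iter-suc k x)
      k≤N : k ≤ N
      k≤N = ≤-trans (m≤n⇒m≤1+n (m≤n+m k (toℕ i)))
                    (subst (_≤ N) (sym eq) (toℕ≤pred[n] j))
    palindrome : ¬ (p (iter (toℕ i) x) ≡ q (p (iter (toℕ j) x)))
    palindrome e = no-palindrome k (q (p y)) (q-injective
        (trans (sym (iter-suc (suc k) y)) (trans (sym e′) (sym (q-inv (p y))))))
      where
      y = iter (toℕ i) x
      e′ : p y ≡ iter (suc (suc k)) y
      e′ = trans e (trans (sym (iter-suc (toℕ j) x))
                   (trans (cong (λ m → iter m x) (sym i+2+k≡1+j))
                          (iter-+ (toℕ i) (suc (suc k)) x)))
        where
        i+2+k≡1+j : toℕ i + suc (suc k) ≡ suc (toℕ j)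
        i+2+k≡1+j = trans (+-comm (toℕ i) (suc (suc k))) (cong suc (sym j≡))

  -- The trace of a walk: closed under `p`, closed under `q` away from `S` and the start, and
  -- meeting `S` at most in the endpoints. Such a set traps face paths, which is how sides are shown
  -- not to share a face.
  data Visits : ∀ {k x z} → Walk k x z → A → Set where
    start : ∀ {k x z} {w : Walk k x z} → Visits w x
    end   : ∀ {x} {s : S (p x)} → Visits (done s) (p x)
    enter : ∀ {k x z} {¬s : ¬ S (p x)} {w : Walk k (q (p x)) z} → Visits (step ¬s w) (p x)
    later : ∀ {k x z u} {¬s : ¬ S (p x)} {w : Walk k (q (p x)) z} →
            Visits w u → Visits (step ¬s w) u

  visits-end : ∀ {k x z} (w : Walk k x z) → Visits w z
  visits-end (done _)   = end
  visits-end (step _ w) = later (visits-end w)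

  visits-p : ∀ {k x z u} {w : Walk k x z} → Visits w u → Visits w (p u)
  visits-p {w = done _}   start = end
  visits-p {w = step _ _} start = enter
  visits-p {x = x} {w = w} end   = subst (Visits w) (sym (p-inv x)) start
  visits-p {x = x} {w = w} enter = subst (Visits w) (sym (p-inv x)) start
  visits-p (later v) = later (visits-p v)

  visits-q : ∀ {k x z u} {w : Walk k x z} → Visits w u → ¬ S u → Visits w (q u) ⊎ u ≡ x
  visits-q start _ = inj₂ refl
  visits-q (end {s = s}) ¬s = contradiction s ¬s
  visits-q enter _ = inj₁ (later start)
  visits-q {x = x} {w = w} (later v) ¬s with visits-q v ¬s
  ... | inj₁ v′   = inj₁ (later v′)
  ... | inj₂ refl = inj₁ (subst (Visits w) (sym (q-inv (p x))) enter)

  visits-S : ∀ {k x z u} {w : Walk k x z} → Visits w u → S u → u ≡ x ⊎ u ≡ z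
  visits-S start _ = inj₁ refl
  visits-S end   _ = inj₂ refl
  visits-S (enter {¬s = ¬s}) s = contradiction s ¬s
  visits-S (later {¬s = ¬s} {w} v) s with visits-S v s
  ... | inj₁ refl = contradiction (subst S (q-inv _) (S-q s)) ¬s
  ... | inj₂ u≡z  = inj₂ u≡z

-- Sides, faces and relabelling of sides

∈-allSides : ∀ {n} (x : Side n) → x ∈ allSides n
∈-allSides (e , false) = ∈-concatMap⁺ _ (lose (∈-allFin e) (here refl))
∈-allSides (e , true)  = ∈-concatMap⁺ _ (lose (∈-allFin e) (there (here refl)))

Face : ∀ {n} (w b : Side n → Side n) → Side n → Side n → Set
Face w b = Reach (w ∷ b ∷ [])

face? : ∀ {n} (w b : Side n → Side n) x y → Dec (Face w b x y)
face? w b = Counting.reach? _≟S_ ∈-allSides (w ∷ b ∷ [])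

module _ {n : ℕ} {w b : Side n → Side n} where

  via-w : ∀ {x y} → w x ≡ y → Face w b x y
  via-w eq = here eq ◅ ε

  via-b : ∀ {x y} → b x ≡ y → Face w b x y
  via-b eq = there (here eq) ◅ ε

  face-sym : IsMatching w → IsMatching b → ∀ {x y} → Face w b x y → Face w b y x
  face-sym wm bm = reverse λ
    { {x} (here refl)         → here (proj₁ wm x)
    ; {x} (there (here refl)) → there (here (proj₁ bm x)) }

gS-involutive : ∀ {n} (x : Side n) → gS (gS x) ≡ x
gS-involutive (e , t) = cong (e ,_) (not-involutive t)

gS-matching : ∀ {n} → IsMatching (gS {n})
gS-matching = gS-involutive , λ { (e , false) () ; (e , true) () }

record Flips {n} (s : Fin n → Bool) (w w′ : Side n → Side n) : Set where
  constructor mkFlips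
  field at : ∀ x → flipS s (w x) ≡ w′ (flipS s x)
open Flips

not-xor : ∀ a b → not a xor b ≡ not (a xor b)
not-xor false b = refl
not-xor true  b = sym (not-involutive b)

xor-cancel : ∀ a b → (a xor b) xor b ≡ a
xor-cancel a b = trans (xor-assoc a b b) (trans (cong (a xor_) (xor-same b)) (xor-identityʳ a))

module _ {n : ℕ} where

  flipS-involutive : ∀ s (x : Side n) → flipS s (flipS s x) ≡ x
  flipS-involutive s (e , t) = cong (e ,_) (xor-cancel t (s e))

  flipS-xor : ∀ s s′ (x : Side n) → flipS (λ e → s e xor s′ e) x ≡ flipS s′ (flipS s x)
  flipS-xor s s′ (e , t) = cong (e ,_) (sym (xor-assoc t (s e) (s′ e)))

  flipS-cong : ∀ {s s′ : Fin n → Bool} → (∀ e → s e ≡ s′ e) → ∀ x → flipS s x ≡ flipS s′ x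
  flipS-cong s≗s′ (e , t) = cong (λ a → e , t xor a) (s≗s′ e)

  flipS-gS : ∀ s (x : Side n) → flipS s (gS x) ≡ gS (flipS s x)
  flipS-gS s (e , t) = cong (e ,_) (not-xor t (s e))

  flips-sym : ∀ {s w w′} → Flips {n} s w w′ → Flips s w′ w
  flips-sym {s} {w} {w′} F = mkFlips λ x →
    trans (cong (flipS s ∘ w′) (sym (flipS-involutive s x)))
   (trans (cong (flipS s) (sym (at F (flipS s x)))) (flipS-involutive s (w (flipS s x))))

  flips-trans : ∀ {s s′ w w′ w″} → Flips {n} s w w′ → Flips s′ w′ w″ →
                Flips (λ e → s e xor s′ e) w w″
  flips-trans {s} {s′} {w} {w″ = w″} F F′ = mkFlips λ x →
    trans (flipS-xor s s′ (w x))
   (trans (cong (flipS s′) (at F x))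
   (trans (at F′ (flipS s x)) (cong w″ (sym (flipS-xor s s′ x)))))

  flips-cong : ∀ {s s′ w w′} → (∀ e → s e ≡ s′ e) → Flips {n} s w w′ → Flips s′ w w′
  flips-cong {w = w} {w′} s≗s′ F = mkFlips λ x →
    trans (sym (flipS-cong s≗s′ (w x))) (trans (at F x) (cong w′ (flipS-cong s≗s′ x)))

  -- Applied to the black matching alone, this twists the edges marked by `s`.
  conj : (Fin n → Bool) → (Side n → Side n) → Side n → Side n
  conj s w = flipS s ∘ w ∘ flipS s

  flips-conj : ∀ s w → Flips s (conj s w) w
  flips-conj s w = mkFlips λ x → flipS-involutive s (w (flipS s x))

  conj-matching : ∀ s {w} → IsMatching w → IsMatching (conj s w)
  conj-matching s {w} (inv , fpf) =
      (λ x → trans (cong (flipS s ∘ w) (flipS-involutive s _))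
             (trans (cong (flipS s) (inv _)) (flipS-involutive s x)))
    , (λ x eq → fpf (flipS s x) (trans (sym (flipS-involutive s _)) (cong (flipS s) eq)))

  face-flips : ∀ {s w w′ b b′} → Flips {n} s w w′ → Flips s b b′ →
               ∀ {x y} → Face w b x y → Face w′ b′ (flipS s x) (flipS s y)
  face-flips {s} Fw Fb = gmap (flipS s) λ
    { {x} (here refl)         → here (sym (at Fw x))
    ; {x} (there (here refl)) → there (here (sym (at Fb x))) }

-- Deletion of edge zero.

new : ∀ {m} → Bool → Side (suc m)
new t = zero , t

old : ∀ {m} → Side m → Side (suc m)
old (e , t) = suc e , t

old-injective : ∀ {m} {x y : Side m} → old x ≡ old y → x ≡ y
old-injective refl = refl

old≢ends : ∀ {m} {x : Side m} → ¬ (old x ≡ new false ⊎ old x ≡ new true)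
old≢ends (inj₁ ())
old≢ends (inj₂ ())

module _ {m : ℕ} where

  -- On matchings the default d is never returned.
  pull : Side m → Side (suc m) → Side m
  pull d (zero  , t) = d
  pull d (suc e , t) = e , t

  bypass : (Side (suc m) → Side (suc m)) → Side m → Side (suc m) → Side m
  bypass w x (zero  , t) = pull x (w (new (not t)))
  bypass w x (suc e , t) = e , t

  opaque
    -- A corner ending at edge zero is continued across that edge into the next corner. Opaque, so
    -- that later arguments see it only through `del-view` and `del-unique`.
    del : (Side (suc m) → Side (suc m)) → Side m → Side m
    del w x = bypass w x (w (old x))

  data DelView (w : Side (suc m) → Side (suc m)) (x z : Side m) : Set where
    direct : w (old x) ≡ old z → DelView w x z
    around : ∀ t → w (old x) ≡ new t → w (new (not t)) ≡ old z → DelView w x z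

  opaque
    unfolding del

    del-unique : ∀ {w x z} → DelView w x z → del w x ≡ z
    del-unique (direct eq)      rewrite eq = refl
    del-unique (around t eq eq′) rewrite eq | eq′ = refl

  module _ {w : Side (suc m) → Side (suc m)} (wm : IsMatching w) where

    private
      back : ∀ {x y} → w x ≡ y → w y ≡ x
      back {x} eq = trans (cong w (sym eq)) (proj₁ wm x)

    -- The first alternative says that this end of edge zero is a vertex of degree one.
    new-view : ∀ t → w (new t) ≡ new (not t) ⊎ ∃ λ y → w (new t) ≡ old y
    new-view t with w (new t) in eq
    ... | suc e , t′ = inj₂ (_ , refl)
    ... | zero  , t′ = inj₁ (cong new (¬-not λ { refl → proj₂ wm _ eq }))

    opaque
      unfolding del

      del-view : ∀ x → DelView w x (del w x)
      del-view x with w (old x) in eq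
      ... | suc e , t = direct eq
      ... | zero  , t with w (new (not t)) in eq′
      ... | suc e , t′ = around t eq eq′
      ... | zero  , t′ with new-view (not t)
      ... | inj₂ (_ , eq″) with () ← trans (sym eq′) eq″
      ... | inj₁ eq″ with () ← trans (sym (back eq))
              (trans (cong (w ∘ new) (sym (not-involutive t))) (back eq″))

    -- Deletion merges the two corners beside edge zero, so the far sides of these corners become
    -- partners.
    del-partner : ∀ {t y} → w (new t) ≡ old y → w (new (not t)) ≡ old (del w y)
    del-partner {t} {y} eq with del-view y
    ... | direct eq′ with () ← trans (sym (back eq)) eq′
    ... | around t′ eq′ eq″ with refl ← trans (sym (back eq)) eq′ = eq″

    new-old : ∀ {y} → w (new false) ≡ old y → ∀ t → ∃ λ z → w (new t) ≡ old z
    new-old eq false = _ , eq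
    new-old eq true  = _ , del-partner eq

    del-matching : IsMatching (del w)
    proj₁ del-matching x with del-view x
    ... | direct eq        = del-unique (direct (back eq))
    ... | around t eq eq′ =
      del-unique (around (not t) (back eq′) (trans (cong (w ∘ new) (not-involutive t)) (back eq)))
    proj₂ del-matching x fix with del w x | del-view x
    proj₂ del-matching x refl | _ | direct eq        = proj₂ wm _ eq
    proj₂ del-matching x refl | _ | around t eq eq′ =
      contradiction (trans (sym eq) (back eq′)) λ e → not-¬ refl (cong proj₂ e)

  del-flips : ∀ {s w w′} → IsMatching w → Flips s w w′ → Flips (s ∘ suc) (del w) (del w′)
  del-flips {s} {w} {w′} wm F = mkFlips go
    where
    go : ∀ x → flipS (s ∘ suc) (del w x) ≡ del w′ (flipS (s ∘ suc) x)
    go x with del-view wm x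
    ... | direct eq        = sym (del-unique (direct (trans (sym (at F (old x))) (cong (flipS s) eq))))
    ... | around t eq eq′ = sym (del-unique (around (t xor s zero)
            (trans (sym (at F (old x))) (cong (flipS s) eq))
            (trans (cong (w′ ∘ new) (sym (not-xor t (s zero))))
            (trans (sym (at F (new (not t)))) (cong (flipS s) eq′)))))

  module _ {w b : Side (suc m) → Side (suc m)} (wm : IsMatching w) (bm : IsMatching b) where

    -- A step of the deleted map that jumps over edge zero is two corners of the full map with the
    -- two sides of edge zero in between; the hypothesis joins these.
    face-old : Face w b (new false) (new true) →
               ∀ {x y} → Face (del w) (del b) x y → Face w b (old x) (old y)
    face-old j ε                   = ε
    face-old j (_◅_ {x} (here refl) r) = case-w ◅◅ face-old j r
      where
      across : ∀ t → Face w b (new t) (new (not t))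
      across false = j
      across true  = face-sym wm bm j
      case-w : Face w b (old x) (old (del w x))
      case-w with del-view wm x
      ... | direct eq        = via-w eq
      ... | around t eq eq′ = via-w eq ◅◅ across t ◅◅ via-w eq′
    face-old j (_◅_ {x} (there (here refl)) r) = case-b ◅◅ face-old j r
      where
      across : ∀ t → Face w b (new t) (new (not t))
      across false = j
      across true  = face-sym wm bm j
      case-b : Face w b (old x) (old (del b x))
      case-b with del-view bm x
      ... | direct eq        = via-b eq
      ... | around t eq eq′ = via-b eq ◅◅ across t ◅◅ via-b eq′

-- Putting edge zero back, plain or twisted

-- Moves along `gS` then add nothing to reachability, so the components are exactly the faces.
Glued : ∀ {n} (w b : Side n → Side n) → Set
Glued w b = ∀ x → Face w b x (gS x)

glued-flips : ∀ {n s} {w w′ b b′ : Side n → Side n} → Flips s w w′ → Flips s b b′ →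
              Glued w b → Glued w′ b′
glued-flips {s = s} {w′ = w′} {b′ = b′} Fw Fb U x =
  subst₂ (Face w′ b′) (flipS-involutive s x)
         (trans (flipS-gS s (flipS s x)) (cong gS (flipS-involutive s x)))
         (face-flips Fw Fb (U (flipS s x)))

glued-extend : ∀ {m} {w b : Side (suc m) → Side (suc m)} → IsMatching w → IsMatching b →
               Glued (del w) (del b) → Face w b (new false) (new true) → Glued w b
glued-extend wm bm U j (zero  , false) = j
glued-extend wm bm U j (zero  , true)  = face-sym wm bm j
glued-extend wm bm U j (suc e , t)     = face-old wm bm j (U (e , t))

-- Once the deleted map is Glued, its faces are its components.
Same : ∀ {m} (w b : Side (suc m) → Side (suc m)) → Set
Same {m} w b = ∃ λ t → ∃ λ t′ → ∃ λ (x : Side m) → ∃ λ y →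
  w (new t) ≡ old x × b (new t′) ≡ old y × Face (del w) (del b) x y

-- `Same` refers to some side of edge zero at each end, not to a particular one, so the signs may
-- differ at edge zero: a twist of that edge does not affect it.
same-flips : ∀ {m s r} {w w′ b b′ : Side (suc m) → Side (suc m)} → IsMatching w → IsMatching b →
             Flips s w w′ → Flips r b b′ → (∀ e → s (suc e) ≡ r (suc e)) → Same w b → Same w′ b′
same-flips {s = s} {r} {b′ = b′} wm bm Fw Fb s≗r (t , t′ , x , y , eq , eq′ , p) =
    t xor s zero , t′ xor r zero , flipS (s ∘ suc) x , flipS (s ∘ suc) y
  , trans (sym (at Fw (new t))) (cong (flipS s) eq)
  , trans (sym (at Fb (new t′))) (trans (cong (flipS r) eq′) (cong old (sym (flipS-cong s≗r y))))
  , face-flips (del-flips {s = s} wm Fw)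
               (flips-cong (sym ∘ s≗r) (del-flips {s = r} bm Fb)) p

-- The maps (w, b) and (w, c) differ by a twist of edge zero.  The alternating walk from
-- new false never applies b to one of the four Near sides, so it is the same in both maps;
-- the Near side where it ends decides which of them joins the two sides of edge zero.
module Twist {m : ℕ} {w b c : Side (suc m) → Side (suc m)}
  (wm : IsMatching w) (bm : IsMatching b) (cm : IsMatching c)
  {v : Side m} (b-old : b (new false) ≡ old v)
  (c-new : ∀ t → c (new t) ≡ b (new (not t)))
  (c-old : ∀ {x y} → b (old x) ≡ old y → c (old x) ≡ old y) where

  Near : Side (suc m) → Set
  Near x = proj₁ x ≡ zero ⊎ proj₁ (b x) ≡ zero

  near? : ∀ x → Dec (Near x)
  near? x = (proj₁ x Fin.≟ zero) ⊎-dec (proj₁ (b x) Fin.≟ zero)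

  near-b : ∀ {x} → Near x → Near (b x)
  near-b {x} (inj₁ eq) = inj₂ (trans (cong proj₁ (proj₁ bm x)) eq)
  near-b     (inj₂ eq) = inj₁ eq

  open AlternatingWalk (proj₁ wm) (proj₂ wm) (proj₁ bm) (proj₂ bm) near? near-b

  c≡b : ∀ {x} → ¬ Near x → c x ≡ b x
  c≡b {zero , t}  ¬n = contradiction (inj₁ refl) ¬n
  c≡b {suc e , t} ¬n with b (suc e , t) in eq
  ... | zero   , t′ = contradiction (inj₂ refl) ¬n
  ... | suc e′ , t′ = c-old eq

  walk-face : ∀ {d} → (∀ {x} → ¬ Near x → d x ≡ b x) → ∀ {k x z} → Walk k x z → Face w d x z
  walk-face d≡b (done _)    = via-w refl
  walk-face d≡b (step ¬n r) = via-w refl ◅◅ via-b (d≡b ¬n) ◅◅ walk-face d≡b r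

  walk-old : ∀ {k x z} → Walk k (old x) (old z) → Face (del w) (del b) x z
  walk-old r = go r refl refl
    where
    go : ∀ {k u v x z} → Walk k u v → u ≡ old x → v ≡ old z → Face (del w) (del b) x z
    go (done _) refl eq = via-w (del-unique (direct eq))
    go {x = x} (step ¬n r) refl refl with w (old x) in eq
    ... | zero  , t = contradiction (inj₁ refl) ¬n
    ... | suc e , t with b (suc e , t) in eq′
    ... | zero   , t′ = contradiction (inj₂ refl) ¬n
    ... | suc e′ , t′ =
      via-w (del-unique (direct eq)) ◅◅ via-b (del-unique (direct eq′)) ◅◅ go r refl refl

  data Exit (z : Side (suc m)) : Set where
    across  : z ≡ new true → Exit z
    meets   : ∀ t → b (new t) ≡ z → Exit z

  exit : ∀ {k z} → Walk k (new false) z → Exit z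
  exit {z = zero , false} r = contradiction refl (walk-≢ r)
  exit {z = zero , true}  r = across refl
  exit {z = suc e , t} r with walk-end r
  ... | inj₂ eq with b (suc e , t) in eq′
  exit {z = suc e , t} r | inj₂ refl | zero , t′ =
    meets t′ (trans (cong b (sym eq′)) (proj₁ bm _))

  walk : ∃ λ k → ∃ (Walk k (new false))
  walk with k , _ , z , r ← walk-exists (λ x → Any.index (∈-allSides x))
              (inj₁ ∘ Counting.index-injective _≟S_ ∈-allSides) {new false} (inj₁ refl)
    = k , z , r

  c-to-new : ∀ t {z} → b (new t) ≡ z → c z ≡ new (not t)
  c-to-new t eq = trans (cong c (trans (sym eq)
      (trans (cong (b ∘ new) (sym (not-involutive t))) (sym (c-new (not t))))))
    (proj₁ cm _)

  -- An exit at `new true` or at `b (new true)` closes up with `b`. An exit at `b (new false)`,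
  -- which is `c (new true)`, closes up with `c`; the walk without its first corner is then a face
  -- path of the deleted map between the ends of edge zero.
  joins-or-twist-joins : Face w b (new false) (new true) ⊎
                         (Face w c (new false) (new true) × Same w b)
  joins-or-twist-joins with k , z , r ← walk with exit r
  ... | across refl   = inj₁ (walk-face (λ _ → refl) r)
  ... | meets true eq =
    inj₁ (walk-face (λ _ → refl) r ◅◅ via-b (trans (cong b (sym eq)) (proj₁ bm _)))
  ... | meets false eq with new-view wm false
  ... | inj₁ eq′ = inj₁ (via-w eq′)
  ... | inj₂ (y , eq′) =
    inj₂ ( walk-face c≡b r ◅◅ via-b (c-to-new false eq)
         , false , false , y , v , eq′ , b-old , path r eq′ (trans (sym eq) b-old) )
    where
    path : ∀ {k z} → Walk k (new false) z → w (new false) ≡ old y → z ≡ old v →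
           Face (del w) (del b) y v
    path (done _) eq′ eq with refl ← old-injective (trans (sym eq′) eq) = ε
    path (step ¬n r) eq′ refl with b (w (new false)) in e
    ... | zero  , t = contradiction (inj₂ refl) ¬n
    ... | suc _ , t = via-b (del-unique (direct (trans (cong b (sym eq′)) e))) ◅◅ walk-old r

  -- If the walk exits at a `b`-partner of edge zero, one of `b` and `c` pairs its two endpoints and
  -- so closes the face before `new true` is reached. The remaining exit is incompatible with
  -- `Same`.
  joins-at-most-one : Same w b → Face w b (new false) (new true) →
                      Face w c (new false) (new true) → ⊥
  joins-at-most-one (t , t′ , x , y , eq , eq′ , p) jb jc with k , z , r ← walk with exit r
  -- The old visited sides are closed under `del w` and `del b`, so they contain `old y`. But
  -- `old y` is `Near`, and the walk meets `Near` only in its endpoints, here the two sides of edge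
  -- zero.
  ... | across refl = old≢ends (visits-S (reach-closed (Visits r ∘ old) closed p
                                (subst (Visits r) eq (visits-p (ends t))))
                             (inj₂ (cong proj₁ (trans (cong b (sym eq′)) (proj₁ bm _)))))
    where
    ends : ∀ t → Visits r (new t)
    ends false = start
    ends true  = visits-end r
    closed : ∀ {u v} → Step (del w ∷ del b ∷ []) u v → Visits r (old u) → Visits r (old v)
    closed {u} (here refl) vis with del-view wm u
    ... | direct e        = subst (Visits r) e (visits-p vis)
    ... | around s e e′ = subst (Visits r) e′ (visits-p (ends (not s)))
    closed {u} (there (here refl)) vis with near? (old u)
    ... | yes n = ⊥-elim (old≢ends (visits-S vis n))
    ... | no ¬n with del-view bm u
    ... | around s e e′ = contradiction (inj₂ (cong proj₁ e)) ¬n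
    ... | direct e with visits-q vis ¬n
    ... | inj₁ vis′ = subst (Visits r) e vis′
  ... | meets t″ eb = separate t″ eb (jb , jc)
    where
    -- The set of visited sides is closed under w and d and misses one side of edge zero.
    z-old : ∀ t → b (new t) ≡ z → ¬ (new true ≡ z)
    z-old t e refl with _ , e′ ← new-old bm b-old t with () ← trans (sym e) e′
    stuck : ∀ {d} → (∀ {x} → ¬ Near x → d x ≡ b x) → d (new false) ≡ z → d z ≡ new false →
            ¬ Face w d (new false) (new true)
    stuck {d} d≡b dn dz j with visits-S (reach-closed (Visits r) closed j start) (inj₁ refl)
      where
      closed : ∀ {u v} → Step (w ∷ d ∷ []) u v → Visits r u → Visits r v
      closed (here refl) vis = visits-p vis
      closed {u} (there (here refl)) vis with near? u
      ... | yes n with visits-S vis n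
      ... | inj₁ refl = subst (Visits r) (sym dn) (visits-end r)
      ... | inj₂ refl = subst (Visits r) (sym dz) start
      closed {u} (there (here refl)) vis | no ¬n with visits-q vis ¬n
      ... | inj₁ vis′ = subst (Visits r) (sym (d≡b ¬n)) vis′
      ... | inj₂ refl = contradiction (inj₁ refl) ¬n
    ... | inj₂ e = z-old t″ eb e
    separate : ∀ t → b (new t) ≡ z →
               ¬ (Face w b (new false) (new true) × Face w c (new false) (new true))
    separate false e (jb , _) = stuck (λ _ → refl) e (trans (cong b (sym e)) (proj₁ bm _)) jb
    separate true  e (_ , jc) = stuck c≡b (trans (c-new false) e) (c-to-new true e) jc

-- The recursive condition and aligned orientations

-- For a connected map the outermost `Glued` amounts to having one face; the inner ones are the
-- conditions after successive removals.
Good : ∀ n → (w b : Side n → Side n) → Set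
Good zero    w b = ⊤
Good (suc m) w b = Glued w b × Good m (del w) (del b)

good⇒glued : ∀ n {w b : Side n → Side n} → Good n w b → Glued w b
good⇒glued zero    _       = λ { (() , _) }
good⇒glued (suc m) (U , _) = U

good-flips : ∀ n {s} {w w′ b b′ : Side n → Side n} → IsMatching w → IsMatching b →
             Flips s w w′ → Flips s b b′ → Good n w b → Good n w′ b′
good-flips zero    wm bm Fw Fb _       = tt
good-flips (suc m) wm bm Fw Fb (U , G) =
  glued-flips Fw Fb U ,
  good-flips m (del-matching wm) (del-matching bm) (del-flips wm Fw) (del-flips bm Fb) G

-- The edges constrained to be untwisted are those that join two components or bring a new vertex
-- when edges are put back from last to first: the greedy spanning tree.
Aligned : ∀ n → (w b : Side n → Side n) → (f h : Fin n → Bool) → Set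
Aligned zero    w b f h = ⊤
Aligned (suc m) w b f h =
  (¬ Same w b → f zero ≡ h zero) × Aligned m (del w) (del b) (f ∘ suc) (h ∘ suc)

aligned-flips : ∀ n {s f h} {w w′ b b′ : Side n → Side n} → IsMatching w → IsMatching b →
                Flips s w w′ → Flips s b b′ → IsMatching w′ → IsMatching b′ → Aligned n w′ b′ f h →
                Aligned n w b (λ e → s e xor f e) (λ e → s e xor h e)
aligned-flips zero        wm bm Fw Fb wm′ bm′ _       = tt
aligned-flips (suc m) {s} wm bm Fw Fb wm′ bm′ (a , A) =
  (λ ¬same → cong (s zero xor_)
    (a (¬same ∘ same-flips wm′ bm′ (flips-sym Fw) (flips-sym Fb) (λ _ → refl)))) ,
  aligned-flips m (del-matching wm) (del-matching bm) (del-flips wm Fw) (del-flips bm Fb)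
                (del-matching wm′) (del-matching bm′) A

aligned-xor : ∀ n {w b : Side n → Side n} {f h} (D : Fin n → Bool) → Aligned n w b f h →
              Aligned n w b (λ e → f e xor D e) (λ e → h e xor D e)
aligned-xor zero    D _       = tt
aligned-xor (suc m) D (a , A) = cong (_xor D zero) ∘ a , aligned-xor m (D ∘ suc) A

-- Vertex orientations as alternating colourings

not-xor-not : ∀ a b → not a xor not b ≡ a xor b
not-xor-not false b = not-involutive b
not-xor-not true  b = refl

colour : ∀ {n} → (Fin n → Bool) → Side n → Bool
colour f x = proj₂ (flipS f x)

colour-xor : ∀ {n} (f D : Fin n → Bool) x →
             colour (λ e → f e xor D e) x ≡ colour f x xor D (proj₁ x)
colour-xor f D (e , t) = sym (xor-assoc t (f e) (D e))

-- Since `gS` always changes the colour, colours alternate all the way around each vertex. The two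
-- ways to do this are its two orientations.
record Alternates {n} (f : Fin n → Bool) (w : Side n → Side n) : Set where
  constructor mkAlternates
  field alternate : ∀ x → colour f (w x) ≡ not (colour f x)
open Alternates

cons : ∀ {m} → Bool → (Fin m → Bool) → Fin (suc m) → Bool
cons c f zero    = c
cons c f (suc e) = f e

module _ {n : ℕ} {w : Side n → Side n} where

  alternates-xor : ∀ {f} (D : Fin n → Bool) → (∀ x → D (proj₁ (w x)) ≡ D (proj₁ x)) →
                   Alternates f w → Alternates (λ e → f e xor D e) w
  alternates-xor {f} D inv alt = mkAlternates λ x →
    trans (colour-xor f D (w x))
   (trans (cong₂ _xor_ (alternate alt x) (inv x))
   (trans (not-xor (colour f x) _) (cong not (sym (colour-xor f D x)))))

  colour-difference : ∀ (f f′ : Fin n → Bool) x →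
                      colour f x xor colour f′ x ≡ f (proj₁ x) xor f′ (proj₁ x)
  colour-difference f f′ (e , false) = refl
  colour-difference f f′ (e , true)  = not-xor-not (f e) (f′ e)

  -- Two alternating colourings change together along `w`, so their difference is constant around a
  -- vertex.
  alternates-difference : ∀ {f f′} → Alternates f w → Alternates f′ w → ∀ x →
    f (proj₁ (w x)) xor f′ (proj₁ (w x)) ≡ f (proj₁ x) xor f′ (proj₁ x)
  alternates-difference {f} {f′} alt alt′ x =
    trans (sym (colour-difference f f′ (w x)))
   (trans (cong₂ _xor_ (alternate alt x) (alternate alt′ x))
   (trans (not-xor-not (colour f x) (colour f′ x)) (colour-difference f f′ x)))

module _ {m : ℕ} {w : Side (suc m) → Side (suc m)} (wm : IsMatching w) where

  -- Going around edge zero takes two corners and one crossing: three changes of colour, the same as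
  -- one.
  alternates-del : ∀ {f} → Alternates f w → Alternates (f ∘ suc) (del w)
  alternates-del {f} alt = mkAlternates go
    where
    go : ∀ x → colour (f ∘ suc) (del w x) ≡ not (colour (f ∘ suc) x)
    go x with del-view wm x
    ... | direct eq       = trans (cong (colour f) (sym eq)) (alternate alt (old x))
    ... | around t eq eq′ =
      trans (cong (colour f) (sym eq′))
     (trans (alternate alt (new (not t)))
     (trans (cong not (not-xor t (f zero)))
     (trans (not-involutive _)
     (trans (cong (colour f) (sym eq)) (alternate alt (old x))))))

  alternates-extend : ∀ {c f} → Alternates f (del w) →
    (∀ t → colour (cons c f) (w (new t)) ≡ not (t xor c)) → Alternates (cons c f) w
  alternates-extend {c} {f} alt alt-new = mkAlternates go
    where
    go : ∀ x → colour (cons c f) (w x) ≡ not (colour (cons c f) x)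
    go (zero  , t) = alt-new t
    go (suc e , t) with del-view wm (e , t)
    ... | direct eq       = trans (cong (colour (cons c f)) eq) (alternate alt (e , t))
    ... | around t′ eq eq′ =
      trans (cong (colour (cons c f)) eq)
     (trans (sym (not-involutive _))
            (cong not (trans (sym (alt-new t′)) (cong (colour (cons c f))
              (trans (cong w (sym eq)) (proj₁ wm _))))))

  alternates-extend-loop : ∀ {c f} → Alternates f (del w) → w (new false) ≡ new true →
                           Alternates (cons c f) w
  alternates-extend-loop {c} {f} alt eq = alternates-extend alt λ
    { false → cong (colour (cons c f)) eq
    ; true  → trans (cong (colour (cons c f)) (trans (cong w (sym eq)) (proj₁ wm _)))
                    (sym (not-involutive c)) }

  -- The neighbour `old y` forces the colour of `new false`. The side `new true` then fits, its
  -- neighbour `old (del w y)` having the colour opposite to that of `old y`.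
  alternates-extend-old : ∀ {f y} → Alternates f (del w) → w (new false) ≡ old y →
                          Alternates (cons (not (colour f y)) f) w
  alternates-extend-old {f} {y} alt eq = alternates-extend alt λ
    { false → trans (cong (colour (cons _ f)) eq) (sym (not-involutive _))
    ; true  → trans (cong (colour (cons _ f)) (del-partner wm eq))
                    (trans (alternate alt y) (sym (not-involutive _))) }

-- Existence and uniqueness of aligned orientations

Orientation : ∀ n → (w b : Side n → Side n) → Set
Orientation n w b = ∃ λ f → ∃ λ h → Alternates f w × Alternates h b × Aligned n w b f h

-- If the two ends of the new edge lie in different components, reversing one of these
-- components makes the orientations at both ends match.
reorient : ∀ {m} {w b : Side m → Side m} → IsMatching w → IsMatching b → Glued w b →
  ∀ {y z} → ¬ Face w b y z → ((f , h , _) : Orientation m w b) →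
  Σ (Orientation m w b) λ (f , h , _) → colour f y ≡ colour h z
reorient {m} {w} {b} wm bm U {y} {z} ¬yz (f , h , altf , alth , A)
  with colour f y Bool.≟ colour h z
... | yes eq = (f , h , altf , alth , A) , eq
... | no  ≢  = ( (λ e → f e xor D e) , (λ e → h e xor D e)
               , alternates-xor D (λ x → D-step {x} (via-w refl)) altf
               , alternates-xor D (λ x → D-step {x} (via-b refl)) alth
               , aligned-xor m D A ) , match
  where
  -- `D` marks the component of `y`. Testing side `false` suffices: by `Glued` both sides of an edge
  -- lie on one face.
  D : Fin m → Bool
  D e = does (face? w b y (e , false))
  D-side : ∀ x → D (proj₁ x) ≡ does (face? w b y x)
  D-side (e , false) = refl
  D-side (e , true)  = does-⇔ (mk⇔ (_◅◅ U (e , false)) (_◅◅ U (e , true))) (face? w b y _) (face? w b y _)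
  D-step : ∀ {x x′} → Face w b x x′ → D (proj₁ x′) ≡ D (proj₁ x)
  D-step {x} {x′} p = trans (D-side x′) (trans
    (does-⇔ (mk⇔ (_◅◅ face-sym wm bm p) (_◅◅ p)) (face? w b y x′) (face? w b y x)) (sym (D-side x)))
  Dy : D (proj₁ y) ≡ true
  Dy = trans (D-side y) (dec-true (face? w b y y) ε)
  Dz : D (proj₁ z) ≡ false
  Dz = trans (D-side z) (dec-false (face? w b y z) ¬yz)
  match : colour (λ e → f e xor D e) y ≡ colour (λ e → h e xor D e) z
  match = trans (colour-xor f D y)
         (trans (cong (colour f y xor_) Dy)
         (trans (xor-true (colour f y))
         (trans (sym (¬-not (≢ ∘ sym)))
         (trans (sym (xor-identityʳ _))
         (trans (cong (colour h z xor_) (sym Dz)) (sym (colour-xor h D z)))))))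
    where
    xor-true : ∀ a → a xor true ≡ not a
    xor-true false = refl
    xor-true true  = refl

orient : ∀ n {w b : Side n → Side n} → IsMatching w → IsMatching b → Good n w b →
         Orientation n w b
orient zero    wm bm _ = (λ ()) , (λ ()) , mkAlternates (λ { (() , _) }) , mkAlternates (λ { (() , _) }) , tt
orient (suc m) {w} {b} wm bm (U , G)
  with orient m (del-matching wm) (del-matching bm) G | new-view wm false | new-view bm false
... | f , h , altf , alth , A | inj₁ eq | inj₁ eq′ =
  cons false f , cons false h , alternates-extend-loop wm altf eq ,
  alternates-extend-loop bm alth eq′ , (λ _ → refl) , A
... | f , h , altf , alth , A | inj₁ eq | inj₂ (z , eq′) =
  -- A vertex of degree one accepts either sign; the `refl` below sets it equal to the sign forced
  -- at the other end.
  _ , _ , alternates-extend-loop wm altf eq ,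
  alternates-extend-old bm alth eq′ , (λ _ → refl) , A
... | f , h , altf , alth , A | inj₂ (y , eq) | inj₁ eq′ =
  _ , _ , alternates-extend-old wm altf eq ,
  alternates-extend-loop bm alth eq′ , (λ _ → refl) , A
... | O@(f , h , altf , alth , A) | inj₂ (y , eq) | inj₂ (z , eq′) with face? (del w) (del b) y z
... | yes yz =
  _ , _ , alternates-extend-old wm altf eq , alternates-extend-old bm alth eq′ ,
  (λ ¬same → contradiction (false , false , y , z , eq , eq′ , yz) ¬same) , A
... | no ¬yz with reorient (del-matching wm) (del-matching bm) (good⇒glued m G) ¬yz O
... | (f , h , altf , alth , A) , fy≡hz =
  _ , _ , alternates-extend-old wm altf eq , alternates-extend-old bm alth eq′ ,
  (λ _ → cong not fy≡hz) , A

-- If edge zero is not needed to connect its component, both differences are constant along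
-- that component, hence agree at edge zero because they agree elsewhere.
differences-agree : ∀ n {w b : Side n → Side n} → IsMatching w → IsMatching b →
  ∀ {f f′ h h′} → Alternates f w → Alternates f′ w → Alternates h b → Alternates h′ b →
  Aligned n w b f h → Aligned n w b f′ h′ → ∀ e → f e xor f′ e ≡ h e xor h′ e
differences-agree (suc m) {w} {b} wm bm {f} {f′} {h} {h′} F F′ H H′ (a , A) (a′ , A′) = go
  where
  F₁  = alternates-del wm F
  F₁′ = alternates-del wm F′
  H₁  = alternates-del bm H
  H₁′ = alternates-del bm H′
  d k : Fin (suc m) → Bool
  d e = f e xor f′ e
  k e = h e xor h′ e
  rest : ∀ e → d (suc e) ≡ k (suc e)
  rest = differences-agree m (del-matching wm) (del-matching bm) F₁ F₁′ H₁ H₁′ A A′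
  same⇒≡ : Same w b → d zero ≡ k zero
  same⇒≡ (t , t′ , x , y , eq , eq′ , p) =
    trans (sym (alternates-difference F F′ (new t)))
   (trans (cong (d ∘ proj₁) eq)
   (trans (reach-closed (λ u → d (suc (proj₁ x)) ≡ d (suc (proj₁ u))) closed p refl)
   (trans (rest (proj₁ y))
   (trans (cong (k ∘ proj₁) (sym eq′)) (alternates-difference H H′ (new t′))))))
    where
    closed : ∀ {u v} → Step (del w ∷ del b ∷ []) u v →
             d (suc (proj₁ x)) ≡ d (suc (proj₁ u)) → d (suc (proj₁ x)) ≡ d (suc (proj₁ v))
    closed {u} (here refl) e = trans e (sym (alternates-difference F₁ F₁′ u))
    closed {u} (there (here refl)) e =
      trans e (trans (rest _) (trans (sym (alternates-difference H₁ H₁′ u)) (sym (rest _))))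
  go : ∀ e → d e ≡ k e
  go (suc e) = rest e
  go zero    = decidable-stable (d zero Bool.≟ k zero) λ ≢ →
    ≢ (cong₂ _xor_ (a (≢ ∘ same⇒≡)) (a′ (≢ ∘ same⇒≡)))

-- Existence and uniqueness of twists

module _ {m : ℕ} {b c d : Side (suc m) → Side (suc m)} {r s : Fin (suc m) → Bool}
  (Fb : Flips r b d) (Fc : Flips s c d) (r≗s : ∀ e → r (suc e) ≡ s (suc e))
  where

  -- Both `b` and `c` are relabellings of `d`, and the relabellings agree away from edge zero; so
  -- sides with the same name in `d` have the same old partner.
  transfer : ∀ {u v y} → flipS s u ≡ flipS r v → b v ≡ old y → c u ≡ old y
  transfer {u} {v} {y} eq bv = involution-injective (flipS s) (flipS-involutive s)
    (trans (at Fc u) (trans (cong d eq) (trans (sym (at Fb v))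
    (trans (cong (flipS r) bv) (cong old (flipS-cong r≗s y))))))

  twist-old : ∀ {x y} → b (old x) ≡ old y → c (old x) ≡ old y
  twist-old {x} = transfer (cong old (flipS-cong (sym ∘ r≗s) x))

  twist-new : IsMatching b → ¬ (r zero ≡ s zero) → ∀ {v} → b (new false) ≡ old v →
              ∀ t → c (new t) ≡ b (new (not t))
  twist-new bm r≢s b-old t with y , eq ← new-old bm b-old (not t) = trans (transfer flip-eq eq) (sym eq)
    where
    flip-eq : flipS s (new t) ≡ flipS r (new (not t))
    flip-eq = cong new (trans (sym (not-involutive _)) (trans (cong not
      (sym (trans (cong (t xor_) (¬-not r≢s)) (xor-not t (s zero))))) (sym (not-xor t (r zero)))))
      where
      xor-not : ∀ a b → a xor not b ≡ not (a xor b)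
      xor-not false b = refl
      xor-not true  b = refl

-- Undoing `s` on both matchings of the second map gives the same `w` and a `b` changed by the signs
-- where `s` and `r` differ, at most edge zero. Were they to differ there, both twists of that edge
-- would join its sides, against `joins-at-most-one`.
same⇒signs-agree : ∀ {m} {w b w′ b′ : Side (suc m) → Side (suc m)} {s r} →
  IsMatching w → IsMatching b → IsMatching b′ → Flips s w w′ → Flips r b b′ →
  (∀ e → s (suc e) ≡ r (suc e)) → Glued w b → Glued w′ b′ → Same w b → s zero ≡ r zero
same⇒signs-agree {b = b} {b′ = b′} {s} {r} wm bm bm′ Fw Fb s≗r U U′ same@(_ , t′ , _ , _ , _ , eq′ , _)
  with new-view bm false
... | inj₁ loop = ⊥-elim (no-loop t′ eq′)
  where
  no-loop : ∀ t {y} → ¬ (b (new t) ≡ old y)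
  no-loop false eq with () ← trans (sym loop) eq
  no-loop true  eq with () ← trans (sym eq) (trans (cong b (sym loop)) (proj₁ bm _))
... | inj₂ (v , b-old) = decidable-stable (s zero Bool.≟ r zero) λ s≢r →
  Twist.joins-at-most-one wm bm (conj-matching s bm′) b-old
    (twist-new Fb (flips-conj s b′) (sym ∘ s≗r) bm (s≢r ∘ sym) b-old)
    (twist-old Fb (flips-conj s b′) (sym ∘ s≗r))
    same (U (new false))
    (glued-flips (flips-sym Fw) (flips-sym (flips-conj s b′)) U′ (new false))

-- At an edge that is `Same` the twist is forced by gluing; at any other edge both alignments say
-- that it is untwisted.
signs-agree : ∀ n {w b w′ b′ : Side n → Side n} →
  IsMatching w → IsMatching b → IsMatching w′ → IsMatching b′ → ∀ {f f′ h h′} →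
  Flips (λ e → f e xor f′ e) w w′ → Flips (λ e → h e xor h′ e) b b′ →
  Good n w b → Good n w′ b′ → Aligned n w b f h → Aligned n w′ b′ f′ h′ →
  ∀ e → f e xor f′ e ≡ h e xor h′ e
signs-agree (suc m) {w} {b} wm bm wm′ bm′ {f} {f′} {h} {h′} Fw Fb (U , G) (U′ , G′) (a , A) (a′ , A′) = go
  where
  rest : ∀ e → f (suc e) xor f′ (suc e) ≡ h (suc e) xor h′ (suc e)
  rest = signs-agree m (del-matching wm) (del-matching bm) (del-matching wm′) (del-matching bm′)
           (del-flips wm Fw) (del-flips bm Fb) G G′ A A′
  same⇒≡ : Same w b → f zero xor f′ zero ≡ h zero xor h′ zero
  same⇒≡ = same⇒signs-agree wm bm bm′ Fw Fb rest U U′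
  go : ∀ e → f e xor f′ e ≡ h e xor h′ e
  go (suc e) = rest e
  go zero    = decidable-stable (_ Bool.≟ _) λ ≢ →
    ≢ (cong₂ _xor_ (a (≢ ∘ same⇒≡))
        (a′ (≢ ∘ same⇒≡ ∘ same-flips wm′ bm′ (flips-sym Fw) (flips-sym Fb) rest)))

flips-refl : ∀ {n} {w : Side n → Side n} → Flips (λ _ → false) w w
flips-refl {w = w} = mkFlips λ x → trans (unflip (w x)) (cong w (sym (unflip x)))
  where
  unflip : ∀ x → flipS (λ _ → false) x ≡ x
  unflip (e , t) = cong (e ,_) (xor-identityʳ t)

-- The untwisted edge is preferred. The twist is used only when it is needed, and then the ends are
-- `Same`, so alignment asks nothing.
choose-signs : ∀ n {w b : Side n → Side n} → IsMatching w → IsMatching b →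
  ∃ λ h → Good n w (conj h b) × Aligned n w (conj h b) (λ _ → false) h
choose-signs zero    wm bm = (λ ()) , tt , tt
choose-signs (suc m) {w} {b} wm bm
  with h , G , A ← choose-signs m (del-matching wm) (del-matching bm) = result
  where
  b[_] : Bool → Side (suc m) → Side (suc m)
  b[ c ] = conj (cons c h) b
  bm[_] : ∀ c → IsMatching b[ c ]
  bm[ c ] = conj-matching (cons c h) bm
  Fb[_] : ∀ c → Flips (cons c h) b[ c ] b
  Fb[ c ] = flips-conj (cons c h) b
  -- A pointwise equality, phrased as a flip by the constant `false` so that `good-flips` and
  -- `aligned-flips` can transport along it.
  del-b : ∀ c → Flips (λ _ → false) (conj h (del b)) (del b[ c ])
  del-b c = flips-cong (xor-same ∘ h)
    (flips-trans (flips-conj h (del b)) (flips-sym (del-flips bm[ c ] Fb[ c ])))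
  extend : ∀ c → Face w b[ c ] (new false) (new true) → (¬ Same w b[ c ] → false ≡ c) →
    ∃ λ h → Good (suc m) w (conj h b) × Aligned (suc m) w (conj h b) (λ _ → false) h
  extend c j a = cons c h , (glued-extend wm bm[ c ] (good⇒glued m G′) j , G′) ,
    a , aligned-flips m (del-matching wm) (del-matching bm[ c ]) flips-refl (flips-sym (del-b c))
          (del-matching wm) (conj-matching h (del-matching bm)) A
    where
    G′ : Good m (del w) (del b[ c ])
    G′ = good-flips m (del-matching wm) (conj-matching h (del-matching bm)) flips-refl (del-b c) G
  result : ∃ λ h → Good (suc m) w (conj h b) × Aligned (suc m) w (conj h b) (λ _ → false) h
  result with new-view bm[ false ] false
  ... | inj₁ loop = extend false (via-b loop) (λ _ → refl)
  ... | inj₂ (v , b-old)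
    with Twist.joins-or-twist-joins wm bm[ false ] bm[ true ] b-old
           (twist-new Fb[ false ] Fb[ true ] (λ _ → refl) bm[ false ] (λ ()) b-old)
           (λ {x} {y} → twist-old Fb[ false ] Fb[ true ] (λ _ → refl) {x} {y})
  ... | inj₁ j          = extend false j (λ _ → refl)
  ... | inj₂ (j , same) = extend true j λ ¬same →
    contradiction (same-flips wm bm[ false ] flips-refl
      (flips-trans Fb[ false ] (flips-sym Fb[ true ])) (sym ∘ xor-same ∘ h) same) ¬same

-- Removing an initial segment of edges

reach-reverse : {A : Set} {fs : List (A → A)} (K : A → Set) →
  (∀ {x y} → Step fs x y → K x → K y × Step fs y x) → ∀ {x y} → K x → Reach fs x y → Reach fs y x
reach-reverse K c k ε       = ε
reach-reverse K c k (s ◅ r) = let k′ , s′ = c s k in reach-reverse K c k′ r ◅◅ (s′ ◅ ε)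

alive-old : ∀ {m} i (x : Side m) → T (alive i x) → T (alive (suc i) (old x))
alive-old zero    x a = tt
alive-old (suc i) x a = a

alive-old⁻ : ∀ {m} i (x : Side m) → T (alive (suc i) (old x)) → T (alive i x)
alive-old⁻ zero    x a = tt
alive-old⁻ (suc i) x a = a

module Around {n : ℕ} (i : ℕ) {w : Side n → Side n} (wm : IsMatching w) where

  open AlternatingWalk (proj₁ wm) (proj₂ wm) (proj₁ gS-matching) (proj₂ gS-matching)
    {S = T ∘ alive i} (λ _ → T? _) id public

  nextAlive-walk : ∀ {k l x z} → Walk k x z → k ≤ l → nextAlive l i w (w x) ≡ z
  nextAlive-walk {l = zero}          (done a)    _ = refl
  nextAlive-walk {l = suc l} {x}     (done a)    _ with alive i (w x)
  ... | true = refl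
  nextAlive-walk {l = suc l} {x} (step ¬a v) (s≤s k≤l) with alive i (w x)
  ... | true  = contradiction tt ¬a
  ... | false = nextAlive-walk v k≤l

  same-edge : ∀ {u v : Side n} → proj₁ u ≡ proj₁ v → u ≡ v ⊎ u ≡ gS v
  same-edge {e , false} {e , false} refl = inj₁ refl
  same-edge {e , false} {e , true}  refl = inj₂ refl
  same-edge {e , true}  {e , false} refl = inj₂ refl
  same-edge {e , true}  {e , true}  refl = inj₁ refl

  restrict-walk : ∀ {x} → T (alive i x) → ∃ λ k → Walk k x (restrict i w x)
  -- Two sides of one edge are exchanged by `gS`, so the pigeonhole argument on the `n` edges bounds
  -- the walk by `n`, the fuel of `restrict`.
  restrict-walk a with k , k≤n , z , v ← walk-exists proj₁ same-edge a =
    k , subst (Walk k _) (sym (nextAlive-walk v k≤n)) v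

  restrict-alive : ∀ {x} → T (alive i x) → T (alive i (restrict i w x))
  restrict-alive a = walk-end (proj₂ (restrict-walk a))

module _ {m : ℕ} (i : ℕ) {w : Side (suc m) → Side (suc m)} (wm : IsMatching w) where

  private
    module D = Around i (del-matching wm)
    module W = Around (suc i) wm

  -- Each corner of the deleted map that passes edge zero costs one more step, across an edge that
  -- is not alive at level `suc i`.
  walk-lift : ∀ {k x z} → D.Walk k x z → ∃ λ l → W.Walk l (old x) (old z)
  walk-lift {x = x} (D.done a) with del-view wm x
  ... | direct eq = _ , subst (W.Walk _ _) eq
                          (W.done (subst (T ∘ alive (suc i)) (sym eq) (alive-old i (del w x) a)))
  ... | around t eq eq′ = _ , W.step (λ a′ → subst (T ∘ alive (suc i)) eq a′)
          (subst (λ u → W.Walk zero (gS u) (old (del w x))) (sym eq)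
            (subst (W.Walk _ _) eq′
              (W.done (subst (T ∘ alive (suc i)) (sym eq′) (alive-old i (del w x) a)))))
  walk-lift {x = x} {z} (D.step ¬a v) with l , v′ ← walk-lift v | del-view wm x
  ... | direct eq = _ , W.step (¬a ∘ alive-old⁻ i (del w x) ∘ subst (T ∘ alive (suc i)) eq)
                          (subst (λ u → W.Walk l (gS u) (old z)) (sym eq) v′)
  ... | around t eq eq′ = _ , W.step (λ a′ → subst (T ∘ alive (suc i)) eq a′)
          (subst (λ u → W.Walk (suc l) (gS u) (old z)) (sym eq)
            (W.step (¬a ∘ alive-old⁻ i (del w x) ∘ subst (T ∘ alive (suc i)) eq′)
              (subst (λ u → W.Walk l (gS u) (old z)) (sym eq′) v′)))

  -- Removing edges at once agrees with removing them successively: walks to the first surviving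
  -- side are deterministic, whatever the fuel.
  restrict-suc : ∀ {x} → T (alive i x) → restrict (suc i) w (old x) ≡ old (restrict i (del w) x)
  restrict-suc {x} a =
    W.walk-functional (proj₂ (W.restrict-walk (alive-old i x a)))
                      (proj₂ (walk-lift (proj₂ (D.restrict-walk a))))

restrict-zero : ∀ {n} (w : Side n → Side n) x → restrict 0 w x ≡ w x
restrict-zero {suc n} w x = refl

restrict-involutive : ∀ {n} i {w : Side n → Side n} → IsMatching w → ∀ {x} → T (alive i x) →
                      restrict i w (restrict i w x) ≡ x
restrict-involutive zero {w} wm {x} a =
  trans (restrict-zero w _) (trans (cong w (restrict-zero w x)) (proj₁ wm x))
restrict-involutive {suc m} (suc i) {w} wm {suc e , t} a =
  trans (cong (restrict (suc i) w) (restrict-suc i wm a′))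
 (trans (restrict-suc i wm (Around.restrict-alive i (del-matching wm) a′))
        (cong old (restrict-involutive i (del-matching wm) a′)))
  where
  a′ = alive-old⁻ i (e , t) a

GluedFrom : ∀ {n} → ℕ → (w b : Side n → Side n) → Set
GluedFrom i w b = ∀ x → T (alive i x) → Face (restrict i w) (restrict i b) x (gS x)

module _ {n : ℕ} (i : ℕ) {w b : Side n → Side n} (wm : IsMatching w) (bm : IsMatching b) where

  private
    faceMaps compMaps : List (Side n → Side n)
    faceMaps = restrict i w ∷ restrict i b ∷ []
    compMaps = gS ∷ faceMaps

    isAlive : ∀ {x} → x ∈ aliveSides n i → T (alive i x)
    isAlive x∈ = proj₂ (∈-filter⁻ (T? ∘ alive i) {xs = allSides n} x∈)

    face-step : ∀ {x y} → Step faceMaps x y → T (alive i x) → T (alive i y) × Step faceMaps y x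
    face-step (here refl)         a =
      Around.restrict-alive i wm a , here (restrict-involutive i wm a)
    face-step (there (here refl)) a =
      Around.restrict-alive i bm a , there (here (restrict-involutive i bm a))

    comp-step : ∀ {x y} → Step compMaps x y → T (alive i x) → T (alive i y) × Step compMaps y x
    comp-step (here refl) a = a , here (gS-involutive _)
    comp-step (there s)   a = let a′ , s′ = face-step s a in a′ , there s′

    face⇒comp : ∀ {x y} → Reach faceMaps x y → Reach compMaps x y
    face⇒comp = kleisliStar id λ s → there s ◅ ε

  cancel-isolated : ∀ {c f} k l → c + k + l ≡ f + k + l → c ≡ f
  cancel-isolated k l eq = +-cancelʳ-≡ k _ _ (+-cancelʳ-≡ l _ _ eq)

  -- Once isolated vertices are cancelled, the faces refine the components with equal counts, so the
  -- partitions agree; and `gS` stays within a component.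
  components≡faces⇒glued : componentsAfter i w b ≡ facesAfter i w b → GluedFrom i w b
  components≡faces⇒glued eq x a =
    Counting.numComponents-≡⇒⊇ _≟S_ ∈-allSides face⇒comp
      (λ x∈ _ → reach-reverse (T ∘ alive i) face-step (isAlive x∈))
      (λ x∈ _ → reach-reverse (T ∘ alive i) comp-step (isAlive x∈))
      (sym (cancel-isolated (isolated i w) (isolated i b) eq))
      (∈-filter⁺ (T? ∘ alive i) (∈-allSides x) a)
      (∈-filter⁺ (T? ∘ alive i) (∈-allSides (gS x)) a)
      (here refl ◅ ε)

  glued⇒components≡faces : GluedFrom i w b → componentsAfter i w b ≡ facesAfter i w b
  glued⇒components≡faces U = cong (λ c → c + isolated i w + isolated i b)
    (Counting.numComponents-cong _≟S_ ∈-allSides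
      (λ x∈ _ → comp⇒face (isAlive x∈)) (λ _ _ → face⇒comp))
    where
    comp⇒face : ∀ {x y} → T (alive i x) → Reach compMaps x y → Reach faceMaps x y
    comp⇒face a ε                 = ε
    comp⇒face a (here refl ◅ r) = U _ a ◅◅ comp⇒face a r
    comp⇒face a (there s ◅ r)   = s ◅ comp⇒face (proj₁ (face-step s a)) r

module _ {m : ℕ} (i : ℕ) {w b : Side (suc m) → Side (suc m)} (wm : IsMatching w) (bm : IsMatching b)
  where

  private
    alive-restrict : ∀ {v : Side m → Side m} → IsMatching v → ∀ {x} → T (alive i x) → _
    alive-restrict = Around.restrict-alive i

  gluedFrom-del : GluedFrom (suc i) w b → GluedFrom i (del w) (del b)
  gluedFrom-del U x a = down a (U (old x) (alive-old i x a))
    where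
    down : ∀ {x y} → T (alive i x) → Face (restrict (suc i) w) (restrict (suc i) b) (old x) (old y) →
           Face (restrict i (del w)) (restrict i (del b)) x y
    down a r = go a refl refl r
      where
      go : ∀ {x y u v} → T (alive i x) → u ≡ old x → v ≡ old y →
           Face (restrict (suc i) w) (restrict (suc i) b) u v →
           Face (restrict i (del w)) (restrict i (del b)) x y
      go a refl eq ε with refl ← old-injective eq = ε
      go a refl eq (here refl ◅ r) =
        via-w refl ◅◅ go (alive-restrict (del-matching wm) a) (restrict-suc i wm a) eq r
      go a refl eq (there (here refl) ◅ r) =
        via-b refl ◅◅ go (alive-restrict (del-matching bm) a) (restrict-suc i bm a) eq r

  gluedFrom-del⁻ : GluedFrom i (del w) (del b) → GluedFrom (suc i) w b
  gluedFrom-del⁻ U (suc e , t) a = up a′ (U (e , t) a′)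
    where
    a′ = alive-old⁻ i (e , t) a
    up : ∀ {x y} → T (alive i x) → Face (restrict i (del w)) (restrict i (del b)) x y →
         Face (restrict (suc i) w) (restrict (suc i) b) (old x) (old y)
    up a ε                         = ε
    up a (here refl ◅ r)         =
      via-w (restrict-suc i wm a) ◅◅ up (alive-restrict (del-matching wm) a) r
    up a (there (here refl) ◅ r) =
      via-b (restrict-suc i bm a) ◅◅ up (alive-restrict (del-matching bm) a) r

module _ {n : ℕ} {w b : Side n → Side n} where

  gluedFrom-zero : GluedFrom 0 w b → Glued w b
  gluedFrom-zero U x = kleisliStar id unrestrict (U x tt)
    where
    unrestrict : ∀ {x y} → Step (restrict 0 w ∷ restrict 0 b ∷ []) x y → Face w b x y
    unrestrict {x} (here refl)         = via-w (sym (restrict-zero w x))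
    unrestrict {x} (there (here refl)) = via-b (sym (restrict-zero b x))

  gluedFrom-zero⁻ : Glued w b → GluedFrom 0 w b
  gluedFrom-zero⁻ U x _ = kleisliStar id rerestrict (U x)
    where
    rerestrict : ∀ {x y} → Step (w ∷ b ∷ []) x y → Face (restrict 0 w) (restrict 0 b) x y
    rerestrict {x} (here refl)         = via-w (restrict-zero w x)
    rerestrict {x} (there (here refl)) = via-b (restrict-zero b x)

gluedFrom⇒good : ∀ n {w b : Side n → Side n} → IsMatching w → IsMatching b →
                 (∀ i → i < n → GluedFrom i w b) → Good n w b
gluedFrom⇒good zero    wm bm U = tt
gluedFrom⇒good (suc m) wm bm U = gluedFrom-zero (U 0 z<s) ,
  gluedFrom⇒good m (del-matching wm) (del-matching bm)
    λ i i<m → gluedFrom-del i wm bm (U (suc i) (s<s i<m))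

good⇒gluedFrom : ∀ n {w b : Side n → Side n} → IsMatching w → IsMatching b →
                 Good n w b → ∀ i → i < n → GluedFrom i w b
good⇒gluedFrom (suc m) wm bm (U , G) zero    _         = gluedFrom-zero⁻ U
good⇒gluedFrom (suc m) wm bm (U , G) (suc i) (s<s i<m) =
  gluedFrom-del⁻ i wm bm (good⇒gluedFrom m (del-matching wm) (del-matching bm) G i i<m)

-- Maps, permutations and their correspondence

Linked : ∀ {n} (w b : Side n → Side n) → Set
Linked w b = ∀ x y → Reach (gS ∷ w ∷ b ∷ []) x y

module _ {n : ℕ} where

  open NonOrientedOrdered

  glued-map : (M : NonOrientedOrdered n) → Good n (w M) (b M)
  glued-map M = gluedFrom⇒good n (w-match M) (b-match M) λ
    -- `cond` starts at 1; before any removal the single face takes its place.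
    { zero    i<n → gluedFrom-zero⁻ λ x →
        Counting.numComponents≡1⇒connected _≟S_ ∈-allSides
          (λ _ _ → face-sym (w-match M) (b-match M))
          (oneFace M) (∈-allSides x) (∈-allSides (gS x))
    ; (suc i) i<n → components≡faces⇒glued (suc i) (w-match M) (b-match M) (cond M (suc i) (s≤s z≤n) i<n) }

  linked-map : (M : NonOrientedOrdered n) → Linked (w M) (b M)
  linked-map M x y = Counting.numComponents≡1⇒connected _≟S_ ∈-allSides
    (λ _ _ → reach-reverse (λ _ → ⊤) (λ s _ → _ , reverse-step s) _)
    (conn M) (∈-allSides x) (∈-allSides y)
    where
    reverse-step : ∀ {x y} → Step (gS ∷ w M ∷ b M ∷ []) x y → Step (gS ∷ w M ∷ b M ∷ []) y x
    reverse-step (here refl)                 = here (gS-involutive _)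
    reverse-step (there (here refl))         = there (here (proj₁ (w-match M) _))
    reverse-step (there (there (here refl))) = there (there (here (proj₁ (b-match M) _)))

  makeMap : {w b : Side n → Side n} → IsMatching w → IsMatching b → Side n →
            Linked w b → Good n w b → NonOrientedOrdered n
  makeMap {w} {b} wm bm r L G = record
    { w = w ; b = b ; w-match = wm ; b-match = bm ; root = r
    ; conn    = Counting.connected⇒numComponents≡1 _≟S_ ∈-allSides (∈-allSides r) λ _ _ → L _ _
    ; oneFace = Counting.connected⇒numComponents≡1 _≟S_ ∈-allSides (∈-allSides r) λ _ _ →
        kleisliStar id link⇒face (L _ _)
    ; cond    = λ i _ i<n → glued⇒components≡faces i wm bm (good⇒gluedFrom n wm bm G i i<n) }
    where
    link⇒face : ∀ {x y} → Step (gS ∷ w ∷ b ∷ []) x y → Face w b x y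
    link⇒face (here refl) = good⇒glued n G _
    link⇒face (there s)   = s ◅ ε

  rotations : Permutation′ n → Permutation′ n → List (Fin n → Fin n)
  rotations σ α = (σ ⟨$⟩ʳ_) ∷ (σ ⟨$⟩ˡ_) ∷ (α ⟨$⟩ʳ_) ∷ (α ⟨$⟩ˡ_) ∷ []

  rotation-reverse : ∀ {σ α e e′} → Reach (rotations σ α) e e′ → Reach (rotations σ α) e′ e
  rotation-reverse {σ} {α} = reach-reverse (λ _ → ⊤) (λ s _ → _ , reverse-step s) _
    where
    reverse-step : ∀ {e e′} → Step (rotations σ α) e e′ → Step (rotations σ α) e′ e
    reverse-step (here refl)                         = there (here (inverseˡ σ))
    reverse-step (there (here refl))                 = here (inverseʳ σ)
    reverse-step (there (there (here refl)))         = there (there (there (here (inverseˡ α))))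
    reverse-step (there (there (there (here refl)))) = there (there (here (inverseʳ α)))

  -- The corner from edge `e` to `σ e` pairs side `false` of the former with side `true` of the
  -- latter.
  fromRotation : Permutation′ n → Side n → Side n
  fromRotation σ (e , false) = σ ⟨$⟩ʳ e , true
  fromRotation σ (e , true)  = σ ⟨$⟩ˡ e , false

  fromRotation-matching : ∀ σ → IsMatching (fromRotation σ)
  fromRotation-matching σ =
      (λ { (e , false) → cong (_, false) (inverseˡ σ) ; (e , true) → cong (_, true) (inverseʳ σ) })
    , (λ { (e , false) () ; (e , true) () })

  flips⇒alternates : ∀ {f w σ} → Flips f w (fromRotation σ) → Alternates f w
  flips⇒alternates {f} {w} {σ} F = mkAlternates λ x →
    trans (cong proj₂ (at F x)) (crosses (flipS f x))
    where
    crosses : ∀ x → proj₂ (fromRotation σ x) ≡ not (proj₂ x)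
    crosses (e , false) = refl
    crosses (e , true)  = refl

  -- By alternation `conj f w` exchanges sides `false` and `true`; its two halves are a permutation
  -- and its inverse.
  rotation : ∀ {f w} → IsMatching w → Alternates f w → ∃ λ σ → Flips f w (fromRotation σ)
  rotation {f} {w} wm alt = σ , mkFlips λ x →
      trans (cong (flipS f ∘ w) (sym (flipS-involutive f x))) (sym (from≡v (flipS f x)))
    where
    v : Side n → Side n
    v = conj f w
    v-inv : ∀ x → v (v x) ≡ x
    v-inv = proj₁ (conj-matching f wm)
    v-side : ∀ x → proj₂ (v x) ≡ not (proj₂ x)
    v-side x = trans (alternate alt (flipS f x)) (cong (not ∘ proj₂) (flipS-involutive f x))
    back : ∀ e t → proj₁ (v (proj₁ (v (e , t)) , not t)) ≡ e
    back e t = cong proj₁ (trans (cong (λ s → v (proj₁ (v (e , t)) , s)) (sym (v-side (e , t))))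
                                 (v-inv (e , t)))
    σ : Permutation′ n
    σ = permutation (λ e → proj₁ (v (e , false))) (λ e → proj₁ (v (e , true)))
                    (λ e → back e true) (λ e → back e false)
    from≡v : ∀ x → fromRotation σ x ≡ v x
    from≡v (e , false) = cong (proj₁ (v (e , false)) ,_) (sym (v-side (e , false)))
    from≡v (e , true)  = cong (proj₁ (v (e , true)) ,_) (sym (v-side (e , true)))

  -- M and O correspond if reversing orientations at the white vertices (f) and at the
  -- black vertices (h) turns M into O, with edges of the greedy spanning tree untwisted.
  record Corresponds (M : NonOrientedOrdered n) (O : OrientedOrdered n) : Set where
    module O = OrientedOrdered O
    field
      f h     : Fin n → Bool
      white   : Flips f (w M) (fromRotation O.σ)
      black   : Flips h (b M) (fromRotation O.α)
      aligned : Aligned n (w M) (b M) f h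
      root≡   : flipS f (root M) ≡ (O.root , false)

  edge-linked : ∀ {w b : Side n → Side n} {x y} → proj₁ x ≡ proj₁ y → Reach (gS ∷ w ∷ b ∷ []) x y
  edge-linked {x = e , false} {e , false} refl = ε
  edge-linked {x = e , false} {e , true}  refl = here refl ◅ ε
  edge-linked {x = e , true}  {e , false} refl = here refl ◅ ε
  edge-linked {x = e , true}  {e , true}  refl = ε

  linked⇒connected : ∀ {w b f h σ α} → Fin n → Flips f w (fromRotation σ) →
    Flips h b (fromRotation α) → Linked w b → orientedConnected σ α
  linked⇒connected {w} {b} {f} {h} {σ} {α} r Fw Fb L =
    Counting.connected⇒numComponents≡1 Fin._≟_ ∈-allFin (∈-allFin r) λ _ _ →
      project (L (_ , false) (_ , false))
    where
    along : ∀ x → Reach (rotations σ α) (proj₁ x) (proj₁ (fromRotation σ x))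
    along (e , false) = here refl ◅ ε
    along (e , true)  = there (here refl) ◅ ε
    along′ : ∀ x → Reach (rotations σ α) (proj₁ x) (proj₁ (fromRotation α x))
    along′ (e , false) = there (there (here refl)) ◅ ε
    along′ (e , true)  = there (there (there (here refl))) ◅ ε
    project : ∀ {x y} → Reach (gS ∷ w ∷ b ∷ []) x y → Reach (rotations σ α) (proj₁ x) (proj₁ y)
    project ε                     = ε
    project (here refl ◅ r)       = project r
    project (_◅_ {x} (there (here refl)) r) =
      subst (Reach _ _) (cong proj₁ (sym (at Fw x))) (along (flipS f x)) ◅◅ project r
    project (_◅_ {x} (there (there (here refl))) r) =
      subst (Reach _ _) (cong proj₁ (sym (at Fb x))) (along′ (flipS h x)) ◅◅ project r

  connected⇒linked : ∀ {w b f h σ α} → Flips f w (fromRotation σ) →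
    Flips h b (fromRotation α) → orientedConnected σ α → Linked w b
  connected⇒linked {w} {b} {f} {h} {σ} {α} Fw Fb c x y =
    lift x y (Counting.numComponents≡1⇒connected Fin._≟_ ∈-allFin
                (λ _ _ → rotation-reverse {σ} {α}) c (∈-allFin (proj₁ x)) (∈-allFin (proj₁ y)))
    where
    white-step : ∀ x e t → proj₁ x ≡ e →
                 Reach (gS ∷ w ∷ b ∷ []) x (w (flipS f (e , t)))
    white-step x e t eq = edge-linked eq ◅◅ (there (here refl) ◅ ε)
    black-step : ∀ x e t → proj₁ x ≡ e →
                 Reach (gS ∷ w ∷ b ∷ []) x (b (flipS h (e , t)))
    black-step x e t eq = edge-linked eq ◅◅ (there (there (here refl)) ◅ ε)
    image : ∀ {s v v′} → Flips s v v′ → ∀ x → proj₁ (v (flipS s x)) ≡ proj₁ (v′ x)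
    image {s} {v} {v′} F x = trans (cong proj₁ (at F (flipS s x))) (cong (proj₁ ∘ v′) (flipS-involutive s x))
    lift : ∀ x y → Reach (rotations σ α) (proj₁ x) (proj₁ y) → Reach (gS ∷ w ∷ b ∷ []) x y
    lift x y r = go x refl r
      where
      go : ∀ x {e} → proj₁ x ≡ e → Reach (rotations σ α) e (proj₁ y) → Reach (gS ∷ w ∷ b ∷ []) x y
      go x eq ε = edge-linked eq
      go x {e} eq (here refl ◅ r) =
        white-step x e false eq ◅◅ go _ (image Fw (e , false)) r
      go x {e} eq (there (here refl) ◅ r) =
        white-step x e true eq ◅◅ go _ (image Fw (e , true)) r
      go x {e} eq (there (there (here refl)) ◅ r) =
        black-step x e false eq ◅◅ go _ (image Fb (e , false)) r
      go x {e} eq (there (there (there (here refl))) ◅ r) =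
        black-step x e true eq ◅◅ go _ (image Fb (e , true)) r

  -- Adding the constant c reverses all orientations, so that the root gets side false.
  toOriented : (M : NonOrientedOrdered n) → ∃ (Corresponds M)
  toOriented M = record { σ = proj₁ white ; α = proj₁ black ; root = proj₁ (root M)
                        ; conn = linked⇒connected (proj₁ (root M)) (proj₂ white) (proj₂ black)
                                                  (linked-map M) }
               , record { white = proj₂ white ; black = proj₂ black
                        ; aligned = aligned-xor n (λ _ → c) aligned
                        ; root≡ = cong (proj₁ (root M) ,_)
                                       (trans (colour-xor f (λ _ → c) (root M)) (xor-same c)) }
    where
    orientation : Orientation n (w M) (b M)
    orientation = orient n (w-match M) (b-match M) (glued-map M)
    f h : Fin n → Bool
    f = proj₁ orientation
    h = proj₁ (proj₂ orientation)
    aligned : Aligned n (w M) (b M) f h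
    aligned = proj₂ (proj₂ (proj₂ (proj₂ orientation)))
    c : Bool
    c = colour f (root M)
    white : ∃ λ σ → Flips (λ e → f e xor c) (w M) (fromRotation σ)
    white = rotation (w-match M)
      (alternates-xor (λ _ → c) (λ _ → refl) (proj₁ (proj₂ (proj₂ orientation))))
    black : ∃ λ α → Flips (λ e → h e xor c) (b M) (fromRotation α)
    black = rotation (b-match M)
      (alternates-xor (λ _ → c) (λ _ → refl) (proj₁ (proj₂ (proj₂ (proj₂ orientation)))))

  toNonOriented : (O : OrientedOrdered n) → ∃ λ M → Corresponds M O
  toNonOriented O
    with h , G , A ← choose-signs n (fromRotation-matching (OrientedOrdered.σ O))
                                    (fromRotation-matching (OrientedOrdered.α O))
    = makeMap (fromRotation-matching O.σ) (conj-matching h (fromRotation-matching O.α)) (O.root , false)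
        (connected⇒linked {f = λ _ → false} {h} {O.σ} {O.α} flips-refl (flips-conj h _) O.conn) G
    , record { white = flips-refl ; black = flips-conj h _ ; aligned = A ; root≡ = refl }
    where module O = OrientedOrdered O

  -- The two orientations, compared on `M`, differ by the same sign at both ends of every edge. The
  -- difference is therefore constant on the connected map, and it vanishes at the root, which both
  -- send to side `false`.
  corresponds-cong : ∀ {M M′ O O′} → M ≈N M′ → Corresponds M O → Corresponds M′ O′ → O ≈O O′
  corresponds-cong {M} {M′} {O} {O′} (s , sw , sb , sr) C C′ =
      (λ e → cong proj₁ (rotations-agree {O.σ} {O′.σ} C.white Fw d≡0 (e , false)))
    , (λ e → cong proj₁ (rotations-agree {O.α} {O′.α} C.black Fb k≡0 (e , false)))
    , trans (sym (cong proj₁ C.root≡)) (cong proj₁ root′)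
    where
    module O = OrientedOrdered O
    module O′ = OrientedOrdered O′
    module C = Corresponds C
    module C′ = Corresponds C′
    f′ h′ d k : Fin n → Bool
    f′ e = s e xor C′.f e
    h′ e = s e xor C′.h e
    d e = C.f e xor f′ e
    k e = C.h e xor h′ e
    Fw : Flips f′ (w M) (fromRotation O′.σ)
    Fw = flips-trans (mkFlips sw) C′.white
    Fb : Flips h′ (b M) (fromRotation O′.α)
    Fb = flips-trans (mkFlips sb) C′.black
    root′ : flipS f′ (root M) ≡ (O′.root , false)
    root′ = trans (flipS-xor s C′.f (root M)) (trans (cong (flipS C′.f) sr) C′.root≡)
    d≡k : ∀ e → d e ≡ k e
    d≡k = differences-agree n (w-match M) (b-match M)
      (flips⇒alternates {σ = O.σ} C.white) (flips⇒alternates {σ = O′.σ} Fw)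
      (flips⇒alternates {σ = O.α} C.black) (flips⇒alternates {σ = O′.α} Fb) C.aligned
      (aligned-flips n (w-match M) (b-match M) (mkFlips sw) (mkFlips sb)
                     (w-match M′) (b-match M′) C′.aligned)
    closed : ∀ {x y} → Step (gS ∷ w M ∷ b M ∷ []) x y → d (proj₁ x) ≡ false → d (proj₁ y) ≡ false
    closed (here refl) z = z
    closed {x} (there (here refl)) z = trans (alternates-difference
      (flips⇒alternates {σ = O.σ} C.white) (flips⇒alternates {σ = O′.σ} Fw) x) z
    closed {x} (there (there (here refl))) z = trans (d≡k _) (trans (alternates-difference
      (flips⇒alternates {σ = O.α} C.black) (flips⇒alternates {σ = O′.α} Fb) x)
      (trans (sym (d≡k _)) z))
    d≡0 : ∀ e → d e ≡ false
    d≡0 e = reach-closed (λ x → d (proj₁ x) ≡ false) closed (linked-map M (root M) (e , false))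
      (trans (sym (colour-difference {w = w M} C.f f′ (root M)))
             (cong₂ _xor_ (cong proj₂ C.root≡) (cong proj₂ root′)))
    k≡0 : ∀ e → k e ≡ false
    k≡0 e = trans (sym (d≡k e)) (d≡0 e)
    xor≡false : ∀ a b → a xor b ≡ false → a ≡ b
    xor≡false false false _ = refl
    xor≡false true  true  _ = refl
    rotations-agree : ∀ {σ σ′ v s s′} → Flips s v (fromRotation σ) → Flips s′ v (fromRotation σ′) →
      (∀ e → s e xor s′ e ≡ false) → ∀ x → fromRotation σ x ≡ fromRotation σ′ x
    rotations-agree {σ} {σ′} {v} {s} {s′} F F′ z x =
      trans (cong (fromRotation σ) (sym (flipS-involutive s x)))
     (trans (sym (at F (flipS s x)))
     (trans (s≗s′ (v (flipS s x)))
     (trans (cong (flipS s′ ∘ v) (s≗s′ x))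
     (trans (at F′ (flipS s′ x)) (cong (fromRotation σ′) (flipS-involutive s′ x))))))
      where
      s≗s′ : ∀ x → flipS s x ≡ flipS s′ x
      s≗s′ = flipS-cong λ e → xor≡false (s e) (s′ e) (z e)

  -- Passing through the common oriented map gives one relabelling for the white matchings and one
  -- for the black. They form an isomorphism once they coincide, which is `signs-agree`.
  corresponds-injective : ∀ {M M′ O O′} → O ≈O O′ → Corresponds M O → Corresponds M′ O′ → M ≈N M′
  corresponds-injective {M} {M′} {O} {O′} (σ≗ , α≗ , r≡) C C′ =
    s , at Fw , at (flips-cong (sym ∘ s≗r) Fb) ,
      trans (flipS-xor C.f C′.f (root M))
     (trans (cong (flipS C′.f) (trans C.root≡ (trans (cong (_, false) r≡) (sym C′.root≡))))
            (flipS-involutive C′.f (root M′)))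
    where
    module O = OrientedOrdered O
    module O′ = OrientedOrdered O′
    module C = Corresponds C
    module C′ = Corresponds C′
    s r : Fin n → Bool
    s e = C.f e xor C′.f e
    r e = C.h e xor C′.h e
    retarget : ∀ {f v} {σ σ′ : Permutation′ n} → (∀ e → σ ⟨$⟩ʳ e ≡ σ′ ⟨$⟩ʳ e) →
               Flips f v (fromRotation σ) → Flips f v (fromRotation σ′)
    retarget {f} {v} {σ} {σ′} eq F = mkFlips λ x → trans (at F x) (agree (flipS f x))
      where
      agree : ∀ x → fromRotation σ x ≡ fromRotation σ′ x
      agree (e , false) = cong (_, true) (eq e)
      agree (e , true)  = cong (_, false) (trans (sym (inverseˡ σ′))
        (cong (σ′ ⟨$⟩ˡ_) (trans (sym (eq _)) (inverseʳ σ))))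
    Fw : Flips s (w M) (w M′)
    Fw = flips-trans (retarget {σ = O.σ} {O′.σ} σ≗ C.white) (flips-sym C′.white)
    Fb : Flips r (b M) (b M′)
    Fb = flips-trans (retarget {σ = O.α} {O′.α} α≗ C.black) (flips-sym C′.black)
    s≗r : ∀ e → s e ≡ r e
    s≗r = signs-agree n (w-match M) (b-match M) (w-match M′) (b-match M′) Fw Fb
            (glued-map M) (glued-map M′) C.aligned C′.aligned

theorem2p2 : (n : ℕ) → 1 ≤ n → Bijection (S1 n) (S2 n)
theorem2p2 n _ = record
  { to        = to
  ; cong      = λ {M} {M′} M≈M′ → corresponds-cong {M = M} {M′} M≈M′ (related M) (related M′)
  ; bijective =
      (λ {M} {M′} O≈O′ → corresponds-injective {M = M} {M′} O≈O′ (related M) (related M′))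
    , (λ O → let M , C = toNonOriented O in
        M , λ {M′} M′≈M → corresponds-cong {M = M′} {M} M′≈M (related M′) C) }
  where
  to : NonOrientedOrdered n → OrientedOrdered n
  to M = proj₁ (toOriented M)
  related : ∀ M → Corresponds M (to M)
  related M = proj₂ (toOriented M)
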